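{- Let $q$ be a prime number and $d,\ell\in\mathbb{N}$. Let $f:\mathbb{F}_q^d\to\mathbb{F}_q^{\ell}$ be a scalar respecting function. Let $\epsilon,\kappa>0$ be parameters such that $\kappa\ge\epsilon\gg\frac{1}{q^{1/3}}$. If $f$ passes the test $\mathcal{T}$ with probability $\epsilon$, then there exists a linear function $c:\mathbb{F}_q^d\to\mathbb{F}_q^{\ell}$ such that $$\Pr_{\vec{\alpha}\sim \mathsf{var}(f,\mathcal{T})}\left[\|f(\vec{\alpha})-c(\vec{\alpha})\|\le\kappa\right]\ge\frac{\epsilon^2}{3},$$ where $\vec\alpha$ is uniform over $\mathsf{var}(f,\mathcal{T})$.
   Context: For a function $f:\mathbb{F}_q^d\to\mathbb{F}_q^{\ell}$, the linearity test $\mathcal{T}$ picks $\vec{\alpha},\vec{\beta}\in\mathbb{F}_q^d$ uniformly and independently at random, and accepts iff $f(\vec{\alpha})+f(\vec{\beta})=f(\vec{\alpha}+\vec{\beta})$. Define $S_{f,\mathcal{T}}:=\{(\vec{\alpha},\vec{\beta})\in\mathbb{F}_q^d\times\mathbb{F}_q^d: f(\vec{\alpha})+f(\vec{\beta})=f(\vec{\alpha}+\vec{\beta})\}$ and $\mathsf{var}(f,\mathcal{T}):=\{\vec{\alpha}\in\mathbb{F}_q^d:\exists\vec{\beta}\in\mathbb{F}_q^d \text{ with } (\vec{\alpha},\vec{\beta})\in S_{f,\mathcal{T}}\}$. A function $c$ is linear if $c(\vec\alpha)+c(\vec\beta)=c(\vec\alpha+\vec\beta)$ for all $\vec\alpha,\vec\beta$;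 $f$ is scalar respecting if $f(\gamma\vec{\alpha})=\gamma f(\vec{\alpha})$ for all $\vec\alpha\in\mathbb{F}_q^d$, $\gamma\in\mathbb{F}_q$. For $x,y\in\mathbb{F}_q^\ell$, $\|x-y\|$ denotes the relative Hamming distance, i.e. the fraction of coordinates $i\in[\ell]$ with $x_i\ne y_i$. The notation $\epsilon\gg q^{ -1/3}$ means $\epsilon$ is sufficiently large compared to $q^{ -1/3}$. -}

module Defs where

open import Data.Nat as ℕ using (ℕ; zero; suc; NonZero)
open import Data.Nat.DivMod using (_mod_)
open import Data.Fin using (Fin; toℕ)
open import Data.Fin.Properties using (_≟_)
open import Data.Vec using (Vec; []; _∷_; zipWith; map)
open import Data.Vec.Properties using (≡-dec)
open import Data.List as List using (List; [_]; concatMap; length; filter; allFin)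
open import Data.List.Relation.Unary.Any using (any?)
open import Data.Product using (Σ; _×_; _,_)
open import Data.Integer using (+_)
open import Data.Rational using (ℚ; _/_)
import Data.Rational.Properties as ℚP
open import Relation.Binary.PropositionalEquality using (_≡_)
open import Relation.Nullary using (Dec; yes; no; ¬_)
open import Relation.Nullary.Decidable using (¬?)

toℚ : ℕ → ℚ
toℚ n = + n / 1

-- The prime field 𝔽_q is modelled as Fin q with arithmetic mod q.
-- Points of 𝔽_q^n are Vec (Fin q) n.
module _ (q : ℕ) .{{_ : NonZero q}} where

  _+F_ : Fin q → Fin q → Fin q
  a +F b = (toℕ a ℕ.+ toℕ b) mod q

  _*F_ : Fin q → Fin q → Fin q
  a *F b = (toℕ a ℕ.* toℕ b) mod q

  _+V_ : ∀ {n} → Vec (Fin q) n → Vec (Fin q) n → Vec (Fin q) n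
  u +V v = zipWith _+F_ u v

  _·V_ : ∀ {n} → Fin q → Vec (Fin q) n → Vec (Fin q) n
  γ ·V u = map (γ *F_) u

  allVecs : (n : ℕ) → List (Vec (Fin q) n)
  allVecs zero    = [ [] ]
  allVecs (suc n) = concatMap (λ x → List.map (x ∷_) (allVecs n)) (allFin q)

  module _ {d ℓ : ℕ} where

    ScalarRespecting : (Vec (Fin q) d → Vec (Fin q) ℓ) → Set
    ScalarRespecting f = ∀ (γ : Fin q) (α : Vec (Fin q) d) → f (γ ·V α) ≡ γ ·V f α

    Linear : (Vec (Fin q) d → Vec (Fin q) ℓ) → Set
    Linear c = ∀ (α β : Vec (Fin q) d) → c α +V c β ≡ c (α +V β)

    Accepts : (Vec (Fin q) d → Vec (Fin q) ℓ) → Vec (Fin q) d → Vec (Fin q) d → Set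
    Accepts f α β = f α +V f β ≡ f (α +V β)

    accepts? : ∀ f α β → Dec (Accepts f α β)
    accepts? f α β = ≡-dec _≟_ (f α +V f β) (f (α +V β))

    sizeS : (Vec (Fin q) d → Vec (Fin q) ℓ) → ℕ
    sizeS f = length (concatMap (λ α → filter (accepts? f α) (allVecs d)) (allVecs d))

    inVar? : (f : Vec (Fin q) d → Vec (Fin q) ℓ) → (α : Vec (Fin q) d) → Dec _
    inVar? f α = any? (accepts? f α) (allVecs d)

    varList : (Vec (Fin q) d → Vec (Fin q) ℓ) → List (Vec (Fin q) d)
    varList f = filter (inVar? f) (allVecs d)

  -- number of coordinates where x and y differ (ℓ · ‖x − y‖)
  hammingCount : ∀ {n} → Vec (Fin q) n → Vec (Fin q) n → ℕ
  hammingCount [] [] = 0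
  hammingCount (x ∷ xs) (y ∷ ys) with x ≟ y
  ... | yes _ = hammingCount xs ys
  ... | no _  = suc (hammingCount xs ys)

  CloseWithin : ∀ {n} → ℚ → Vec (Fin q) n → Vec (Fin q) n → Set
  CloseWithin {n} κ x y = toℚ (hammingCount x y) Data.Rational.≤ κ Data.Rational.* toℚ n

  close? : ∀ {n} (κ : ℚ) (x y : Vec (Fin q) n) → Dec (CloseWithin κ x y)
  close? {n} κ x y = toℚ (hammingCount x y) ℚP.≤? κ Data.Rational.* toℚ n

  goodCount : ∀ {d ℓ} → (f c : Vec (Fin q) d → Vec (Fin q) ℓ) → ℚ → ℕ
  goodCount f c κ = length (filter (λ α → close? κ (f α) (c α)) (varList f))

module Submission where

-- For a functional γ on 𝔽_q^ℓ, a linear form c and a set A closed under nonzero scalars, let B_c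
-- be the number of x ∈ A with γ · f(x) = c · x.  Scalar invariance makes the deviation
-- E_c = q B_c − |A| a Fourier coefficient, so Σ E_c² is determined by |A| and Σ E_c³ by the number
-- of accepted pairs x, y with x, y, x + y ∈ A.  Distinct forms agree on at most a fraction 1/q of
-- all points, so Cauchy–Schwarz forces some B_c to be large.
--
-- This is used twice.  Choose γ such that at most a fraction 1/q of all pairs is accepted by γ · f
-- but rejected by f.  With A everything, the function γ · f agrees with some form on a set A₁ of
-- density at least √(ε/2).  Inside A₁ nearly every additive pair is accepted by f, so each
-- coordinate of f agrees with a form on all but a fraction O(1 / (q ε^{3/2})) of A₁.  As
-- κ ≥ ε ≫ q^{-1/3}, Markov's inequality for the Hamming distance leaves half of A₁ within distance κ
-- of the linear map with these coordinates.  Finally var(f, 𝒯) is everything because f(0) = 0.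

open import Defs

-- The obstacle is that ℓ is arbitrary: decoding the coordinates of f separately would give
-- agreement sets that need not overlap. A single γ supplies one set A₁ for all of them, since a
-- random γ misses a nonzero defect with chance only 1/q. All Fourier analysis stays in ℤ: `e` sums
-- the q - 1 nontrivial characters, and by scalar symmetry the corresponding coefficients at a form
-- c coincide, so E_c is q - 1 times their common value. Forms are weighted by E_c² because q B_c =
-- E_c + |A| turns Σ E_c² B_c into a combination of the two known moments. Read as a sum over
-- points, it is the first moment of the weight of the forms that are right at a point. In the
-- second moment of that weight distinct forms contribute little, so the diagonal, and with it the
-- largest E_c², must be large. With s accepted pairs and n = q^d, ε is s / n², and the estimates
-- are cleared of denominators. The output arises as √(ε/2) ≥ 2ε/3, halved by Markov to ε/3 ≥ ε²/3.
-- The constant 200 is a round choice: the certificates of the polynomial inequalities keep positive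
-- leftovers.

module Counting where

  open import Algebra.Bundles using (CommutativeSemiring)
  import Algebra.Solver.Ring.NaturalCoefficients.Default as SemiringSolver
  open import Data.Bool using (if_then_else_)
  open import Data.Empty using (⊥-elim)
  open import Data.Fin using (Fin; zero; suc; toℕ)
  import Data.Fin.Properties as Fin
  open import Data.Integer using (ℤ; +_; +[1+_]; -[1+_]; 0ℤ; 1ℤ; _+_; _*_; _-_; -_; _≤_; _<_; +≤+; +<+; positive)
  open import Data.Integer.Properties hiding (_≟_)
  open import Data.Integer.Tactic.RingSolver using (solve-∀)
  open import Data.List as List using (List; []; _∷_; _++_; allFin; length; filter; concatMap)
  open import Data.List.Membership.Propositional using (_∈_)
  open import Data.List.Membership.Propositional.Properties using (∈-allFin; ∈-concatMap⁺; ∈-map⁺)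
  import Data.List.Properties as List
  open import Data.List.Relation.Unary.All as All using (All)
  open import Data.List.Relation.Unary.AllPairs using (_∷_)
  open import Data.List.Relation.Unary.Any as Any using (here; there)
  open import Data.List.Relation.Unary.Unique.Propositional using (Unique)
  open import Data.List.Relation.Unary.Unique.Propositional.Properties using (allFin⁺)
  open import Data.Nat as ℕ using (ℕ; zero; suc; NonZero; z≤n; z<s)
  open import Data.Nat.Coprimality using (prime⇒coprime; coprime-Bézout)
  open import Data.Nat.DivMod using (_mod_; _%_; m<n⇒m%n≡m; %-distribˡ-+; %-distribˡ-*; n%n≡0)
  open import Data.Nat.GCD using (module Bézout)
  open import Data.Nat.Primality using (Prime; prime⇒nonTrivial)
  import Data.Nat.Properties as ℕ
  open import Data.Product using (_,_; proj₁; proj₂; ∃)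
  open import Data.Sum using (inj₁; inj₂)
  open import Data.Vec as Vec using (Vec; []; _∷_; replicate; tabulate; lookup)
  import Data.Vec.Properties as Vec
  open import Function using (_∘_)
  open import Level using (0ℓ)
  open import Relation.Binary.Definitions using (DecidableEquality)
  open import Relation.Binary.PropositionalEquality
  open import Relation.Nullary using (Dec; yes; no; does; ¬_)
  open import Relation.Unary using (Pred; Decidable)

  private
    variable
      A A′ : Set
      P P′ : Set

  -- Integer inequalities as nonnegative differences.

  infixl 6 _+≥_
  infixr 7 _·≥_

  _+≥_ : ∀ {x y} → 0ℤ ≤ x → 0ℤ ≤ y → 0ℤ ≤ x + y
  _+≥_ = +-mono-≤

  _·≥_ : ∀ {x y} → 0ℤ ≤ x → 0ℤ ≤ y → 0ℤ ≤ x * y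
  _·≥_ {+ m} {+ n} _ _ = subst (0ℤ ≤_) (pos-* m n) (+≤+ z≤n)

  0≤+ : ∀ n → 0ℤ ≤ + n
  0≤+ n = +≤+ z≤n

  sq≥0 : ∀ x → 0ℤ ≤ x * x
  sq≥0 (+ n) = 0≤+ n ·≥ 0≤+ n
  sq≥0 (-[1+ n ]) = +≤+ z≤n

  gap : ∀ {x y} → x ≤ y → 0ℤ ≤ y - x
  gap = i≤j⇒0≤j-i

  ungap : ∀ {x y} → 0ℤ ≤ y - x → x ≤ y
  ungap = 0≤i-j⇒j≤i

  -- The pattern of most later estimates: the difference of the two sides, often times a positive
  -- factor, is rewritten by the ring solver as a sum of products of nonnegative terms, whose sign
  -- is then read off by `_+≥_` and `_·≥_`.
  gap-by : ∀ {x y t} → 0ℤ ≤ t → y - x ≡ t → x ≤ y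
  gap-by t≥0 eq = ungap (subst (0ℤ ≤_) (sym eq) t≥0)

  ·-monoˡ : ∀ {z x y} → 0ℤ ≤ z → x ≤ y → z * x ≤ z * y
  ·-monoˡ {z} {x} {y} z≥0 x≤y = gap-by (z≥0 ·≥ gap x≤y) (id z x y)
    where
    id : ∀ z x y → z * y - z * x ≡ z * (y - x)
    id = solve-∀

  ·-mono : ∀ {x y u v} → 0ℤ ≤ x → x ≤ y → 0ℤ ≤ u → u ≤ v → x * u ≤ y * v
  ·-mono {x} {y} {u} {v} x≥0 x≤y u≥0 u≤v =
    ≤-trans (·-monoˡ x≥0 u≤v)
      (subst₂ _≤_ (*-comm v x) (*-comm v y) (·-monoˡ (≤-trans u≥0 u≤v) x≤y))

  ·-cancel : ∀ {z x y} → 0ℤ < z → z * x ≤ z * y → x ≤ y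
  ·-cancel {z} {x} {y} z>0 p = *-cancelˡ-≤-pos x y z {{positive z>0}} p

  ·-cancel-≡ : ∀ {z x y} → 0ℤ < z → z * x ≡ z * y → x ≡ y
  ·-cancel-≡ z>0 eq = ≤-antisym (·-cancel z>0 (≤-reflexive eq)) (·-cancel z>0 (≤-reflexive (sym eq)))

  ·-pos : ∀ {x y} → 0ℤ < x → 0ℤ < y → 0ℤ < x * y
  ·-pos {x} {y} x>0 y>0 =
    subst (_< x * y) (*-zeroʳ x) (*-monoˡ-<-pos x {{positive x>0}} y>0)

  -- Indicators, finite sums and Cauchy-Schwarz.

  ⟦_⟧ : Dec P → ℤ
  ⟦ d ⟧ = if does d then 1ℤ else 0ℤ

  ⟦⟧-yes : (d : Dec P) → P → ⟦ d ⟧ ≡ 1ℤ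
  ⟦⟧-yes (yes _) p = refl
  ⟦⟧-yes (no ¬p) p = ⊥-elim (¬p p)

  ⟦⟧-no : (d : Dec P) → ¬ P → ⟦ d ⟧ ≡ 0ℤ
  ⟦⟧-no (yes p) ¬p = ⊥-elim (¬p p)
  ⟦⟧-no (no _) ¬p = refl

  ⟦⟧-cong : (d : Dec P) (e : Dec P′) → (P → P′) → (P′ → P) → ⟦ d ⟧ ≡ ⟦ e ⟧
  ⟦⟧-cong (yes p) e f g = sym (⟦⟧-yes e (f p))
  ⟦⟧-cong (no ¬p) e f g = sym (⟦⟧-no e (λ q → ¬p (g q)))

  ⟦⟧≥0 : (d : Dec P) → 0ℤ ≤ ⟦ d ⟧
  ⟦⟧≥0 (yes _) = 0≤+ 1
  ⟦⟧≥0 (no _) = 0≤+ 0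

  ⟦⟧≤1 : (d : Dec P) → ⟦ d ⟧ ≤ 1ℤ
  ⟦⟧≤1 (yes _) = ≤-refl
  ⟦⟧≤1 (no _) = 0≤+ 1

  ⟦⟧-idem : (d : Dec P) → ⟦ d ⟧ * ⟦ d ⟧ ≡ ⟦ d ⟧
  ⟦⟧-idem (yes _) = refl
  ⟦⟧-idem (no _) = refl

  ∑ : List A → (A → ℤ) → ℤ
  ∑ [] F = 0ℤ
  ∑ (x ∷ xs) F = F x + ∑ xs F

  syntax ∑ xs (λ x → t) = ∑[ x ∈ xs ] t
  infix 3 ∑

  ∑-cong : (xs : List A) {F G : A → ℤ} → (∀ x → F x ≡ G x) → ∑ xs F ≡ ∑ xs G
  ∑-cong [] eq = refl
  ∑-cong (x ∷ xs) eq = cong₂ _+_ (eq x) (∑-cong xs eq)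

  ∑-mono : (xs : List A) {F G : A → ℤ} → (∀ x → F x ≤ G x) → ∑ xs F ≤ ∑ xs G
  ∑-mono [] le = ≤-refl
  ∑-mono (x ∷ xs) le = +-mono-≤ (le x) (∑-mono xs le)

  ∑-zero : (xs : List A) → ∑ xs (λ _ → 0ℤ) ≡ 0ℤ
  ∑-zero [] = refl
  ∑-zero (x ∷ xs) = trans (+-identityˡ _) (∑-zero xs)

  ∑≥0 : (xs : List A) {F : A → ℤ} → (∀ x → 0ℤ ≤ F x) → 0ℤ ≤ ∑ xs F
  ∑≥0 xs {F} F≥0 = subst (_≤ ∑ xs F) (∑-zero xs) (∑-mono xs F≥0)

  ∑-+ : (xs : List A) (F G : A → ℤ) → ∑ xs (λ x → F x + G x) ≡ ∑ xs F + ∑ xs G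
  ∑-+ [] F G = refl
  ∑-+ (x ∷ xs) F G = trans (cong (_+_ (F x + G x)) (∑-+ xs F G)) (id (F x) (G x) _ _)
    where
    id : ∀ a b c d → a + b + (c + d) ≡ a + c + (b + d)
    id = solve-∀

  ∑-*ˡ : (xs : List A) (c : ℤ) (F : A → ℤ) → ∑ xs (λ x → c * F x) ≡ c * ∑ xs F
  ∑-*ˡ [] c F = sym (*-zeroʳ c)
  ∑-*ˡ (x ∷ xs) c F = trans (cong (_+_ (c * F x)) (∑-*ˡ xs c F)) (sym (*-distribˡ-+ c (F x) _))

  ∑-*ʳ : (xs : List A) (F : A → ℤ) (c : ℤ) → ∑ xs (λ x → F x * c) ≡ ∑ xs F * c
  ∑-*ʳ xs F c = trans (∑-cong xs (λ x → *-comm (F x) c)) (trans (∑-*ˡ xs c F) (*-comm c _))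

  ∑-minus : (xs : List A) (F G : A → ℤ) → ∑ xs (λ x → F x - G x) ≡ ∑ xs F - ∑ xs G
  ∑-minus [] F G = refl
  ∑-minus (x ∷ xs) F G = trans (cong (_+_ (F x - G x)) (∑-minus xs F G)) (id (F x) (G x) _ _)
    where
    id : ∀ a b c d → a - b + (c - d) ≡ a + c - (b + d)
    id = solve-∀

  ∑-++ : (xs ys : List A) (F : A → ℤ) → ∑ (xs ++ ys) F ≡ ∑ xs F + ∑ ys F
  ∑-++ [] ys F = sym (+-identityˡ _)
  ∑-++ (x ∷ xs) ys F = trans (cong (_+_ (F x)) (∑-++ xs ys F)) (sym (+-assoc (F x) _ _))

  ∑-map : (g : A → A′) (xs : List A) (F : A′ → ℤ) → ∑ (List.map g xs) F ≡ ∑ xs (λ x → F (g x))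
  ∑-map g [] F = refl
  ∑-map g (x ∷ xs) F = cong (_+_ (F (g x))) (∑-map g xs F)

  ∑-concatMap : (g : A → List A′) (xs : List A) (F : A′ → ℤ) →
    ∑ (concatMap g xs) F ≡ ∑ xs (λ x → ∑ (g x) F)
  ∑-concatMap g [] F = refl
  ∑-concatMap g (x ∷ xs) F =
    trans (∑-++ (g x) _ F) (cong (_+_ (∑ (g x) F)) (∑-concatMap g xs F))

  ∑-swap : (xs : List A) (ys : List A′) (F : A → A′ → ℤ) →
    ∑ xs (λ x → ∑ ys (F x)) ≡ ∑ ys (λ y → ∑ xs (λ x → F x y))
  ∑-swap [] ys F = sym (∑-zero ys)
  ∑-swap (x ∷ xs) ys F =
    trans (cong (_+_ (∑ ys (F x))) (∑-swap xs ys F)) (sym (∑-+ ys (F x) _))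

  ∑-product : (xs : List A) (ys : List A′) (F : A → ℤ) (G : A′ → ℤ) →
    ∑ xs F * ∑ ys G ≡ ∑ xs (λ x → ∑ ys (λ y → F x * G y))
  ∑-product xs ys F G =
    trans (sym (∑-*ʳ xs F _)) (∑-cong xs (λ x → sym (∑-*ˡ ys (F x) G)))

  -- Induction: a new point x raises the right side minus the left side by χ x times the sum of χ y
  -- (Φ y - Φ x)².
  cauchy-schwarz : (xs : List A) (χ Φ : A → ℤ) → (∀ x → 0ℤ ≤ χ x) →
    ∑ xs (λ x → χ x * Φ x) * ∑ xs (λ x → χ x * Φ x) ≤ ∑ xs χ * ∑ xs (λ x → χ x * (Φ x * Φ x))
  cauchy-schwarz [] χ Φ χ≥0 = ≤-refl
  cauchy-schwarz (x ∷ xs) χ Φ χ≥0 =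
    gap-by (gap (cauchy-schwarz xs χ Φ χ≥0) +≥
            χ≥0 x ·≥ subst (0ℤ ≤_) square (∑≥0 xs (λ y → χ≥0 y ·≥ sq≥0 (Φ y - Φ x))))
      (id (χ x) (Φ x) (∑ xs χ) (∑ xs (λ y → χ y * Φ y)) (∑ xs (λ y → χ y * (Φ y * Φ y))))
    where
    id : ∀ c p a b s →
      (c + a) * (c * (p * p) + s) - (c * p + b) * (c * p + b)
        ≡ (a * s - b * b) + c * (s - (p + p) * b + p * p * a)
    id = solve-∀
    expand : ∀ c y p → c * ((y - p) * (y - p)) ≡ c * (y * y) - (p + p) * (c * y) + p * p * c
    expand = solve-∀
    square : ∑ xs (λ y → χ y * ((Φ y - Φ x) * (Φ y - Φ x))) ≡
      ∑ xs (λ y → χ y * (Φ y * Φ y)) - (Φ x + Φ x) * ∑ xs (λ y → χ y * Φ y) + Φ x * Φ x * ∑ xs χ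
    square = trans (∑-cong xs (λ y → expand (χ y) (Φ y) (Φ x)))
      (trans (∑-+ xs (λ y → χ y * (Φ y * Φ y) - (Φ x + Φ x) * (χ y * Φ y)) (λ y → Φ x * Φ x * χ y))
        (cong₂ _+_
          (trans (∑-minus xs (λ y → χ y * (Φ y * Φ y)) (λ y → (Φ x + Φ x) * (χ y * Φ y)))
            (cong (_-_ (∑ xs (λ y → χ y * (Φ y * Φ y)))) (∑-*ˡ xs (Φ x + Φ x) (λ y → χ y * Φ y))))
          (∑-*ˡ xs (Φ x * Φ x) χ)))

  -- Maxima and sums over finite types.

  maximum : (xs : List A) {w : A} → w ∈ xs → (F : A → ℤ) →
    ∃ λ m → ∀ {x} → x ∈ xs → F x ≤ F m
  maximum (x ∷ []) _ F = x , λ { (here refl) → ≤-refl }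
  maximum (x ∷ y ∷ xs) _ F with maximum (y ∷ xs) (here refl) F
  ... | m , m-max with ≤-total (F x) (F m)
  ...   | inj₁ le = m , λ { (here refl) → le ; (there i) → m-max i }
  ...   | inj₂ ge = x , λ { (here refl) → ≤-refl ; (there i) → ≤-trans (m-max i) ge }

  -- `sift` expresses that w is listed exactly once, in the form in which sums use it: summation
  -- against a delta function.
  record Enumeration (A : Set) : Set where
    infix 4 _≟_
    field
      elements : List A
      _≟_      : DecidableEquality A
      complete : ∀ x → x ∈ elements
      sift     : ∀ w (F : A → ℤ) → ∑ elements (λ x → ⟦ x ≟ w ⟧ * F x) ≡ F w

  module _ (E : Enumeration A) where
    open Enumeration E

    ∑-single : (F : A → ℤ) → (∀ x → 0ℤ ≤ F x) → ∀ w → F w ≤ ∑ elements F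
    ∑-single F F≥0 w = subst (_≤ ∑ elements F) (sift w F) (∑-mono elements below)
      where
      below : ∀ x → ⟦ x ≟ w ⟧ * F x ≤ F x
      below x with x ≟ w
      ... | yes _ = ≤-reflexive (*-identityˡ (F x))
      ... | no _ = F≥0 x

    -- Double counting: F (σ x) is expanded as a sum over y against the delta y = σ x; after
    -- swapping the sums this delta reads x = τ y.
    ∑-reindex : (σ τ : A → A) → (∀ x → σ (τ x) ≡ x) → (∀ x → τ (σ x) ≡ x) →
      (F : A → ℤ) → ∑ elements (λ x → F (σ x)) ≡ ∑ elements F
    ∑-reindex σ τ στ τσ F = begin
      ∑ elements (λ x → F (σ x))
        ≡⟨ ∑-cong elements (λ x → sift (σ x) F) ⟨
      ∑ elements (λ x → ∑ elements (λ y → ⟦ y ≟ σ x ⟧ * F y))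
        ≡⟨ ∑-swap elements elements _ ⟩
      ∑ elements (λ y → ∑ elements (λ x → ⟦ y ≟ σ x ⟧ * F y))
        ≡⟨ ∑-cong elements (λ y → trans
             (∑-cong elements (λ x → cong (_* F y) (⟦⟧-cong (y ≟ σ x) (x ≟ τ y)
               (λ { refl → sym (τσ x) }) (λ { refl → sym (στ y) }))))
             (sift (τ y) (λ _ → F y))) ⟩
      ∑ elements F ∎
      where open ≡-Reasoning

    maximizer : A → (F : A → ℤ) → ∃ λ m → ∀ x → F x ≤ F m
    maximizer a F with maximum elements (complete a) F
    ... | m , m-max = m , λ x → m-max (complete x)

  unique-sift : {xs : List A} (_≟_ : DecidableEquality A) → Unique xs → ∀ {w} → w ∈ xs →
    (F : A → ℤ) → ∑ xs (λ x → ⟦ x ≟ w ⟧ * F x) ≡ F w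
  unique-sift {xs = x ∷ xs} _≟_ (x∉xs ∷ _) (here refl) F =
    trans (cong₂ _+_ (trans (cong (_* F x) (⟦⟧-yes (x ≟ x) refl)) (*-identityˡ (F x)))
                     (others xs x∉xs))
          (+-identityʳ (F x))
    where
    others : ∀ ys → All (x ≢_) ys → ∑ ys (λ y → ⟦ y ≟ x ⟧ * F y) ≡ 0ℤ
    others [] _ = refl
    others (y ∷ ys) (x≢y All.∷ x∉ys) =
      cong₂ _+_ (cong (_* F y) (⟦⟧-no (y ≟ x) (λ eq → x≢y (sym eq)))) (others ys x∉ys)
  unique-sift {xs = x ∷ xs} _≟_ (x∉xs ∷ u) {w} (there w∈xs) F =
    trans (cong₂ _+_ (cong (_* F x) (⟦⟧-no (x ≟ w) (All.lookup x∉xs w∈xs))) (unique-sift _≟_ u w∈xs F))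
          (+-identityˡ (F w))

  -- The prime field.

  module Residues (q : ℕ) .{{_ : NonZero q}} where

    F : Set
    F = Fin q

    residue : ℕ → F
    residue m = m mod q

    toℕ-residue : ∀ m → toℕ (residue m) ≡ m % q
    toℕ-residue m = Fin.toℕ-fromℕ< _

    residue-toℕ : ∀ a → residue (toℕ a) ≡ a
    residue-toℕ a = Fin.toℕ-injective (trans (toℕ-residue (toℕ a)) (m<n⇒m%n≡m (Fin.toℕ<n a)))

    residue-cong : ∀ {m n} → m % q ≡ n % q → residue m ≡ residue n
    residue-cong {m} {n} eq =
      Fin.toℕ-injective (trans (toℕ-residue m) (trans eq (sym (toℕ-residue n))))

    infixl 6 _⊕_
    infixl 7 _⊗_

    _⊕_ _⊗_ : F → F → F
    _⊕_ = _+F_ q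
    _⊗_ = _*F_ q

    residue-+ : ∀ m n → residue m ⊕ residue n ≡ residue (m ℕ.+ n)
    residue-+ m n = residue-cong
      (trans (cong (_% q) (cong₂ ℕ._+_ (toℕ-residue m) (toℕ-residue n))) (sym (%-distribˡ-+ m n q)))

    residue-* : ∀ m n → residue m ⊗ residue n ≡ residue (m ℕ.* n)
    residue-* m n = residue-cong
      (trans (cong (_% q) (cong₂ ℕ._*_ (toℕ-residue m) (toℕ-residue n))) (sym (%-distribˡ-* m n q)))

    0F 1F : F
    0F = residue 0
    1F = residue 1

    -- The negative of 1, so that subtraction is x ⊕ −1F ⊗ y and the semiring solver applies.
    −1F : F
    −1F = residue (q ℕ.∸ 1)

    by-lift : (l r : F → F) → (∀ m → l (residue m) ≡ r (residue m)) → ∀ a → l a ≡ r a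
    by-lift l r eq a = subst (λ b → l b ≡ r b) (residue-toℕ a) (eq (toℕ a))

    ⊕-comm : ∀ a b → a ⊕ b ≡ b ⊕ a
    ⊕-comm a b = cong residue (ℕ.+-comm (toℕ a) (toℕ b))

    ⊗-comm : ∀ a b → a ⊗ b ≡ b ⊗ a
    ⊗-comm a b = cong residue (ℕ.*-comm (toℕ a) (toℕ b))

    ⊕-assoc : ∀ a b c → (a ⊕ b) ⊕ c ≡ a ⊕ (b ⊕ c)
    ⊕-assoc a b c = begin
      residue (i ℕ.+ j) ⊕ c                 ≡⟨ cong (residue (i ℕ.+ j) ⊕_) (residue-toℕ c) ⟨
      residue (i ℕ.+ j) ⊕ residue k         ≡⟨ residue-+ (i ℕ.+ j) k ⟩
      residue (i ℕ.+ j ℕ.+ k)               ≡⟨ cong residue (ℕ.+-assoc i j k) ⟩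
      residue (i ℕ.+ (j ℕ.+ k))             ≡⟨ residue-+ i (j ℕ.+ k) ⟨
      residue i ⊕ residue (j ℕ.+ k)         ≡⟨ cong (_⊕ residue (j ℕ.+ k)) (residue-toℕ a) ⟩
      a ⊕ residue (j ℕ.+ k) ∎
      where
      open ≡-Reasoning
      i = toℕ a
      j = toℕ b
      k = toℕ c

    ⊗-assoc : ∀ a b c → (a ⊗ b) ⊗ c ≡ a ⊗ (b ⊗ c)
    ⊗-assoc a b c = begin
      residue (i ℕ.* j) ⊗ c                 ≡⟨ cong (residue (i ℕ.* j) ⊗_) (residue-toℕ c) ⟨
      residue (i ℕ.* j) ⊗ residue k         ≡⟨ residue-* (i ℕ.* j) k ⟩
      residue (i ℕ.* j ℕ.* k)               ≡⟨ cong residue (ℕ.*-assoc i j k) ⟩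
      residue (i ℕ.* (j ℕ.* k))             ≡⟨ residue-* i (j ℕ.* k) ⟨
      residue i ⊗ residue (j ℕ.* k)         ≡⟨ cong (_⊗ residue (j ℕ.* k)) (residue-toℕ a) ⟩
      a ⊗ residue (j ℕ.* k) ∎
      where
      open ≡-Reasoning
      i = toℕ a
      j = toℕ b
      k = toℕ c

    ⊗-distribˡ : ∀ a b c → a ⊗ (b ⊕ c) ≡ (a ⊗ b) ⊕ (a ⊗ c)
    ⊗-distribˡ a b c = begin
      a ⊗ residue (j ℕ.+ k)                 ≡⟨ cong (_⊗ residue (j ℕ.+ k)) (residue-toℕ a) ⟨
      residue i ⊗ residue (j ℕ.+ k)         ≡⟨ residue-* i (j ℕ.+ k) ⟩
      residue (i ℕ.* (j ℕ.+ k))             ≡⟨ cong residue (ℕ.*-distribˡ-+ i j k) ⟩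
      residue (i ℕ.* j ℕ.+ i ℕ.* k)         ≡⟨ residue-+ (i ℕ.* j) (i ℕ.* k) ⟨
      residue (i ℕ.* j) ⊕ residue (i ℕ.* k) ∎
      where
      open ≡-Reasoning
      i = toℕ a
      j = toℕ b
      k = toℕ c

    ⊕-identityˡ : ∀ a → 0F ⊕ a ≡ a
    ⊕-identityˡ = by-lift (0F ⊕_) (λ a → a) (residue-+ 0)

    ⊗-identityˡ : ∀ a → 1F ⊗ a ≡ a
    ⊗-identityˡ = by-lift (1F ⊗_) (λ a → a)
      (λ m → trans (residue-* 1 m) (cong residue (ℕ.*-identityˡ m)))

    ⊕-identityʳ : ∀ a → a ⊕ 0F ≡ a
    ⊕-identityʳ a = trans (⊕-comm a 0F) (⊕-identityˡ a)

    ⊗-identityʳ : ∀ a → a ⊗ 1F ≡ a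
    ⊗-identityʳ a = trans (⊗-comm a 1F) (⊗-identityˡ a)

    ⊗-zeroˡ : ∀ a → 0F ⊗ a ≡ 0F
    ⊗-zeroˡ = by-lift (0F ⊗_) (λ _ → 0F) (residue-* 0)

    ⊗-zeroʳ : ∀ a → a ⊗ 0F ≡ 0F
    ⊗-zeroʳ a = trans (⊗-comm a 0F) (⊗-zeroˡ a)

    ⊗-distribʳ : ∀ a b c → (b ⊕ c) ⊗ a ≡ (b ⊗ a) ⊕ (c ⊗ a)
    ⊗-distribʳ a b c =
      trans (⊗-comm (b ⊕ c) a) (trans (⊗-distribˡ a b c) (cong₂ _⊕_ (⊗-comm a b) (⊗-comm a c)))

    residue-q : residue q ≡ 0F
    residue-q = residue-cong (trans (n%n≡0 q) (sym (m<n⇒m%n≡m (ℕ.>-nonZero⁻¹ q))))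

    1⊕−1 : 1F ⊕ −1F ≡ 0F
    1⊕−1 = trans (residue-+ 1 (q ℕ.∸ 1)) (trans (cong residue (ℕ.m+[n∸m]≡n (ℕ.>-nonZero⁻¹ q))) residue-q)

    ⊕-inverse : ∀ a → a ⊕ −1F ⊗ a ≡ 0F
    ⊕-inverse a = begin
      a ⊕ −1F ⊗ a       ≡⟨ cong (_⊕ −1F ⊗ a) (⊗-identityˡ a) ⟨
      1F ⊗ a ⊕ −1F ⊗ a  ≡⟨ ⊗-distribʳ a 1F −1F ⟨
      (1F ⊕ −1F) ⊗ a    ≡⟨ cong (_⊗ a) 1⊕−1 ⟩
      0F ⊗ a            ≡⟨ ⊗-zeroˡ a ⟩
      0F ∎
      where open ≡-Reasoning

    commutativeSemiring : CommutativeSemiring 0ℓ 0ℓ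
    commutativeSemiring = record
      { Carrier = F
      ; _≈_ = _≡_
      ; _+_ = _⊕_
      ; _*_ = _⊗_
      ; 0# = 0F
      ; 1# = 1F
      ; isCommutativeSemiring = record
        { isSemiring = record
          { isSemiringWithoutAnnihilatingZero = record
            { +-isCommutativeMonoid = record
              { isMonoid = record
                { isSemigroup = record
                  { isMagma = record { isEquivalence = isEquivalence ; ∙-cong = cong₂ _⊕_ }
                  ; assoc = ⊕-assoc
                  }
                ; identity = ⊕-identityˡ , ⊕-identityʳ
                }
              ; comm = ⊕-comm
              }
            ; *-cong = cong₂ _⊗_
            ; *-assoc = ⊗-assoc
            ; *-identity = ⊗-identityˡ , ⊗-identityʳ
            ; distrib = ⊗-distribˡ , ⊗-distribʳ
            }
          ; zero = ⊗-zeroˡ , ⊗-zeroʳ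
          }
        ; *-comm = ⊗-comm
        }
      }

    open SemiringSolver commutativeSemiring using (solve; _:+_; _:*_; _:=_)

    ⊕-cancel : ∀ a b → a ⊕ −1F ⊗ b ≡ 0F → a ≡ b
    ⊕-cancel a b eq = begin
      a                    ≡⟨ ⊕-identityʳ a ⟨
      a ⊕ 0F               ≡⟨ cong (a ⊕_) (⊕-inverse b) ⟨
      a ⊕ (b ⊕ −1F ⊗ b)    ≡⟨ solve 3 (λ a b c → a :+ (b :+ c) := a :+ c :+ b) refl a b (−1F ⊗ b) ⟩
      a ⊕ −1F ⊗ b ⊕ b      ≡⟨ cong (_⊕ b) eq ⟩
      0F ⊕ b               ≡⟨ ⊕-identityˡ b ⟩
      b ∎
      where open ≡-Reasoning

    module Field (pr : Prime q) where

      1F≢0F : 1F ≢ 0F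
      1F≢0F eq = ℕ.1+n≢0 (trans (sym (toℕ-small 1<q)) (trans (cong toℕ eq) (toℕ-small 0<q)))
        where
        1<q : 1 ℕ.< q
        1<q = ℕ.nonTrivial⇒n>1 q {{prime⇒nonTrivial pr}}
        0<q : 0 ℕ.< q
        0<q = ℕ.>-nonZero⁻¹ q
        toℕ-small : ∀ {k} → k ℕ.< q → toℕ (residue k) ≡ k
        toℕ-small k<q = trans (toℕ-residue _) (m<n⇒m%n≡m k<q)

      −1F≢0F : −1F ≢ 0F
      −1F≢0F eq = 1F≢0F (trans (sym (⊕-identityʳ 1F)) (trans (cong (1F ⊕_) (sym eq)) 1⊕−1))

      residue-multiple : ∀ x → residue (x ℕ.* q) ≡ 0F
      residue-multiple x =
        trans (sym (residue-* x q)) (trans (cong (residue x ⊗_) residue-q) (⊗-zeroʳ (residue x)))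

      residue-⊗ : ∀ y a → residue y ⊗ a ≡ residue (y ℕ.* toℕ a)
      residue-⊗ y a = trans (cong (residue y ⊗_) (sym (residue-toℕ a))) (residue-* y (toℕ a))

      inverse : ∀ a → a ≢ 0F → ∃ λ b → b ⊗ a ≡ 1F
      inverse a a≢0 = from-Bézout (coprime-Bézout (prime⇒coprime pr {{ℕ.≢-nonZero i≢0}} (Fin.toℕ<n a)))
        where
        open ≡-Reasoning
        i≢0 : toℕ a ≢ 0
        i≢0 i≡0 = a≢0 (trans (sym (residue-toℕ a)) (cong residue i≡0))
        from-Bézout : Bézout.Identity 1 q (toℕ a) → ∃ λ b → b ⊗ a ≡ 1F
        -- Here 1 + y a = x q, so the inverse is -y. Inserting t - t with t = y a avoids a separate
        -- proof that (-1)(-1) = 1.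
        from-Bézout (Bézout.+- x y eq) = −1F ⊗ residue y , sym (⊕-cancel _ _ (begin
          1F ⊕ −1F ⊗ (−1F ⊗ residue y ⊗ a)
            ≡⟨ cong₂ _⊕_ (sym (⊕-identityʳ 1F)) refl ⟩
          1F ⊕ 0F ⊕ −1F ⊗ (−1F ⊗ residue y ⊗ a)
            ≡⟨ cong₂ (λ z w → 1F ⊕ z ⊕ −1F ⊗ w) (sym (⊕-inverse (residue y ⊗ a))) (⊗-assoc −1F (residue y) a) ⟩
          1F ⊕ (residue y ⊗ a ⊕ −1F ⊗ (residue y ⊗ a)) ⊕ −1F ⊗ (−1F ⊗ (residue y ⊗ a))
            ≡⟨ solve 3 (λ o m t → o :+ (t :+ m :* t) :+ m :* (m :* t) := (o :+ t) :+ m :* (t :+ m :* t)) refl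
                 1F −1F (residue y ⊗ a) ⟩
          (1F ⊕ residue y ⊗ a) ⊕ −1F ⊗ (residue y ⊗ a ⊕ −1F ⊗ (residue y ⊗ a))
            ≡⟨ cong₂ (λ z w → z ⊕ −1F ⊗ w)
                 (trans (cong (1F ⊕_) (residue-⊗ y a))
                   (trans (residue-+ 1 (y ℕ.* toℕ a)) (trans (cong residue eq) (residue-multiple x))))
                 (⊕-inverse (residue y ⊗ a)) ⟩
          0F ⊕ −1F ⊗ 0F
            ≡⟨ trans (⊕-identityˡ _) (⊗-zeroʳ −1F) ⟩
          0F ∎))
        from-Bézout (Bézout.-+ x y eq) = residue y , (begin
          residue y ⊗ a            ≡⟨ residue-⊗ y a ⟩
          residue (y ℕ.* toℕ a)    ≡⟨ cong residue eq ⟨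
          residue (1 ℕ.+ x ℕ.* q)  ≡⟨ residue-+ 1 (x ℕ.* q) ⟨
          1F ⊕ residue (x ℕ.* q)   ≡⟨ cong (1F ⊕_) (residue-multiple x) ⟩
          1F ⊕ 0F                  ≡⟨ ⊕-identityʳ 1F ⟩
          1F ∎)

  ∑-const : {A : Set} (xs : List A) (c : ℤ) → ∑ xs (λ _ → c) ≡ + length xs * c
  ∑-const List.[] c = refl
  ∑-const (x List.∷ xs) c = trans (cong (_+_ c) (∑-const xs c)) (sym (suc-* (+ length xs) c))

  -- Linear forms and orthogonality of characters.

  module Vectors (q : ℕ) .{{_ : NonZero q}} (pr : Prime q) where

    open Residues q
    open Field pr
    open SemiringSolver commutativeSemiring using (solve; _:+_; _:*_; _:=_)

    V : ℕ → Set
    V n = Vec F n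

    _≟F_ : DecidableEquality F
    _≟F_ = Fin._≟_

    _≟V_ : ∀ {n} → DecidableEquality (V n)
    _≟V_ = Vec.≡-dec Fin._≟_

    infixl 6 _⊞_
    infixr 7 _⊡_
    infix 8 _∙_

    _⊞_ : ∀ {n} → V n → V n → V n
    _⊞_ = _+V_ q

    _⊡_ : ∀ {n} → F → V n → V n
    _⊡_ = _·V_ q

    0V : ∀ {n} → V n
    0V = replicate _ 0F

    _∙_ : ∀ {n} → V n → V n → F
    [] ∙ [] = 0F
    (x ∷ xs) ∙ (y ∷ ys) = x ⊗ y ⊕ xs ∙ ys

    ⊡-identity : ∀ {n} (x : V n) → 1F ⊡ x ≡ x
    ⊡-identity [] = refl
    ⊡-identity (x ∷ xs) = cong₂ _∷_ (⊗-identityˡ x) (⊡-identity xs)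

    ⊡-zero : ∀ {n} (x : V n) → 0F ⊡ x ≡ 0V
    ⊡-zero [] = refl
    ⊡-zero (x ∷ xs) = cong₂ _∷_ (⊗-zeroˡ x) (⊡-zero xs)

    ⊡-assoc : ∀ {n} s t (x : V n) → s ⊡ t ⊡ x ≡ (s ⊗ t) ⊡ x
    ⊡-assoc s t [] = refl
    ⊡-assoc s t (x ∷ xs) = cong₂ _∷_ (sym (⊗-assoc s t x)) (⊡-assoc s t xs)

    ⊞-identityʳ : ∀ {n} (x : V n) → x ⊞ 0V ≡ x
    ⊞-identityʳ [] = refl
    ⊞-identityʳ (x ∷ xs) = cong₂ _∷_ (⊕-identityʳ x) (⊞-identityʳ xs)

    ⊞-inverse : ∀ {n} (x : V n) → x ⊞ −1F ⊡ x ≡ 0V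
    ⊞-inverse [] = refl
    ⊞-inverse (x ∷ xs) = cong₂ _∷_ (⊕-inverse x) (⊞-inverse xs)

    ⊞-cancel : ∀ {n} (x y : V n) → x ⊞ −1F ⊡ y ≡ 0V → x ≡ y
    ⊞-cancel [] [] eq = refl
    ⊞-cancel (x ∷ xs) (y ∷ ys) eq =
      cong₂ _∷_ (⊕-cancel x y (Vec.∷-injectiveˡ eq)) (⊞-cancel xs ys (Vec.∷-injectiveʳ eq))

    ∙-⊞ : ∀ {n} (c x y : V n) → c ∙ (x ⊞ y) ≡ c ∙ x ⊕ c ∙ y
    ∙-⊞ [] [] [] = sym (⊕-identityˡ 0F)
    ∙-⊞ (c ∷ cs) (x ∷ xs) (y ∷ ys) = trans (cong (c ⊗ (x ⊕ y) ⊕_) (∙-⊞ cs xs ys))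
      (solve 5 (λ c x y a b → c :* (x :+ y) :+ (a :+ b) := c :* x :+ a :+ (c :* y :+ b)) refl
        c x y (cs ∙ xs) (cs ∙ ys))

    ∙-⊡ : ∀ {n} (c : V n) s x → c ∙ (s ⊡ x) ≡ s ⊗ c ∙ x
    ∙-⊡ [] s [] = sym (⊗-zeroʳ s)
    ∙-⊡ (c ∷ cs) s (x ∷ xs) = trans (cong (c ⊗ (s ⊗ x) ⊕_) (∙-⊡ cs s xs))
      (solve 4 (λ c s x a → c :* (s :* x) :+ s :* a := s :* (c :* x :+ a)) refl c s x (cs ∙ xs))

    ∙-comm : ∀ {n} (x y : V n) → x ∙ y ≡ y ∙ x
    ∙-comm [] [] = refl
    ∙-comm (x ∷ xs) (y ∷ ys) = cong₂ _⊕_ (⊗-comm x y) (∙-comm xs ys)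

    ∙-zero : ∀ {n} (x : V n) → 0V ∙ x ≡ 0F
    ∙-zero x = trans (cong (_∙ x) (sym (⊡-zero x))) (trans (∙-comm (0F ⊡ x) x)
      (trans (∙-⊡ x 0F x) (⊗-zeroˡ (x ∙ x))))

    ⊞-tabulate : ∀ {n} (u v : Fin n → F) → tabulate u ⊞ tabulate v ≡ tabulate (λ i → u i ⊕ v i)
    ⊞-tabulate {zero} u v = refl
    ⊞-tabulate {suc n} u v = cong (u zero ⊕ v zero ∷_) (⊞-tabulate (λ i → u (suc i)) (λ i → v (suc i)))

    Q : ℤ
    Q = + q

    fieldEnumeration : Enumeration F
    fieldEnumeration = record
      { elements = allFin q
      ; _≟_ = Fin._≟_
      ; complete = ∈-allFin
      ; sift = λ w → unique-sift Fin._≟_ (allFin⁺ q) (∈-allFin w)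
      }

    open Enumeration fieldEnumeration using () renaming (sift to siftF)

    ∑-allVecs : ∀ n (G : V (suc n) → ℤ) →
      ∑ (allVecs q (suc n)) G ≡ ∑ (allFin q) (λ x → ∑ (allVecs q n) (λ xs → G (x ∷ xs)))
    ∑-allVecs n G = trans (∑-concatMap (λ x → List.map (x ∷_) (allVecs q n)) (allFin q) G)
      (∑-cong (allFin q) (λ x → ∑-map (x ∷_) (allVecs q n) G))

    ⟦∷⟧ : ∀ {n} x y (xs ys : V n) → ⟦ (x ∷ xs) ≟V (y ∷ ys) ⟧ ≡ ⟦ x ≟F y ⟧ * ⟦ xs ≟V ys ⟧
    ⟦∷⟧ x y xs ys with x ≟F y
    ... | no _ = refl
    ... | yes _ with xs ≟V ys
    ...   | no _ = refl
    ...   | yes _ = refl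

    vectors-complete : ∀ {n} (x : V n) → x ∈ allVecs q n
    vectors-complete [] = here refl
    vectors-complete (x ∷ xs) =
      ∈-concatMap⁺ (λ x → List.map (x ∷_) (allVecs q _))
        (Any.map (λ { refl → ∈-map⁺ (x ∷_) (vectors-complete xs) }) (∈-allFin x))

    vectors-sift : ∀ {n} (w : V n) (G : V n → ℤ) → ∑ (allVecs q n) (λ x → ⟦ x ≟V w ⟧ * G x) ≡ G w
    vectors-sift [] G = trans (+-identityʳ _) (*-identityˡ (G []))
    vectors-sift {suc n} (w ∷ ws) G = begin
      ∑ (allVecs q (suc n)) (λ x → ⟦ x ≟V (w ∷ ws) ⟧ * G x)
        ≡⟨ ∑-allVecs n _ ⟩
      ∑ (allFin q) (λ x → ∑ (allVecs q n) (λ xs → ⟦ (x ∷ xs) ≟V (w ∷ ws) ⟧ * G (x ∷ xs)))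
        ≡⟨ ∑-cong (allFin q) (λ x → trans
             (∑-cong (allVecs q n) (λ xs → trans (cong (_* G (x ∷ xs)) (⟦∷⟧ x w xs ws))
               (*-assoc ⟦ x ≟F w ⟧ ⟦ xs ≟V ws ⟧ (G (x ∷ xs)))))
             (trans (∑-*ˡ (allVecs q n) ⟦ x ≟F w ⟧ (λ xs → ⟦ xs ≟V ws ⟧ * G (x ∷ xs)))
               (cong (⟦ x ≟F w ⟧ *_) (vectors-sift ws (λ xs → G (x ∷ xs)))))) ⟩
      ∑ (allFin q) (λ x → ⟦ x ≟F w ⟧ * G (x ∷ ws))
        ≡⟨ siftF w (λ x → G (x ∷ ws)) ⟩
      G (w ∷ ws) ∎
      where open ≡-Reasoning

    vectorEnumeration : ∀ n → Enumeration (V n)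
    vectorEnumeration n = record
      { elements = allVecs q n
      ; _≟_ = _≟V_
      ; complete = vectors-complete
      ; sift = vectors-sift
      }

    N : ℕ → ℤ
    N n = + (q ℕ.^ n)

    ∑F-const : ∀ c → ∑ (allFin q) (λ _ → c) ≡ Q * c
    ∑F-const c = trans (∑-const (allFin q) c) (cong (λ k → + k * c) (List.length-tabulate {n = q} (λ x → x)))

    ∑V-const : ∀ n c → ∑ (allVecs q n) (λ _ → c) ≡ N n * c
    ∑V-const zero c = trans (+-identityʳ c) (sym (*-identityˡ c))
    ∑V-const (suc n) c = begin
      ∑ (allVecs q (suc n)) (λ _ → c)                  ≡⟨ ∑-allVecs n _ ⟩
      ∑ (allFin q) (λ _ → ∑ (allVecs q n) (λ _ → c))   ≡⟨ ∑F-const _ ⟩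
      Q * ∑ (allVecs q n) (λ _ → c)                    ≡⟨ cong (Q *_) (∑V-const n c) ⟩
      Q * (N n * c)                                    ≡⟨ *-assoc Q (N n) c ⟨
      Q * N n * c                                      ≡⟨ cong (_* c) (pos-* q (q ℕ.^ n)) ⟨
      N (suc n) * c ∎
      where open ≡-Reasoning

    -- The sum of the q − 1 nontrivial additive characters at t.
    e : F → ℤ
    e t = Q * ⟦ t ≟F 0F ⟧ - 1ℤ

    ∑e : ∑ (allFin q) e ≡ 0ℤ
    ∑e = begin
      ∑ (allFin q) e
        ≡⟨ ∑-minus (allFin q) (λ t → Q * ⟦ t ≟F 0F ⟧) (λ _ → 1ℤ) ⟩
      ∑ (allFin q) (λ t → Q * ⟦ t ≟F 0F ⟧) - ∑ (allFin q) (λ _ → 1ℤ)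
        ≡⟨ cong₂ _-_
             (trans (∑-cong (allFin q) (λ t → *-comm Q ⟦ t ≟F 0F ⟧)) (siftF 0F (λ _ → Q)))
             (trans (∑F-const 1ℤ) (*-identityʳ Q)) ⟩
      Q - Q
        ≡⟨ +-inverseʳ Q ⟩
      0ℤ ∎
      where open ≡-Reasoning

    -- Orthogonality on a line: for t = 0 the summand is constant, otherwise s ↦ w + s t permutes
    -- the field, over which `e` sums to zero.
    ∑e-affine : ∀ w t → ∑ (allFin q) (λ s → e (w ⊕ s ⊗ t)) ≡ ⟦ t ≟F 0F ⟧ * (Q * e w)
    ∑e-affine w t with t ≟F 0F
    ... | yes refl = begin
      ∑ (allFin q) (λ s → e (w ⊕ s ⊗ 0F))
        ≡⟨ ∑-cong (allFin q) (λ s → cong e (trans (cong (w ⊕_) (⊗-zeroʳ s)) (⊕-identityʳ w))) ⟩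
      ∑ (allFin q) (λ _ → e w)
        ≡⟨ ∑F-const (e w) ⟩
      Q * e w
        ≡⟨ *-identityˡ (Q * e w) ⟨
      1ℤ * (Q * e w) ∎
      where open ≡-Reasoning
    ... | no t≢0 with inverse t t≢0
    ...   | t⁻¹ , t⁻¹t =
      trans (∑-reindex fieldEnumeration (λ s → w ⊕ s ⊗ t) (λ u → (u ⊕ −1F ⊗ w) ⊗ t⁻¹) στ τσ e) ∑e
      where
      open ≡-Reasoning
      στ : ∀ u → w ⊕ (u ⊕ −1F ⊗ w) ⊗ t⁻¹ ⊗ t ≡ u
      στ u = begin
        w ⊕ (u ⊕ −1F ⊗ w) ⊗ t⁻¹ ⊗ t     ≡⟨ cong (w ⊕_) (trans (⊗-assoc (u ⊕ −1F ⊗ w) t⁻¹ t)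
            (trans (cong ((u ⊕ −1F ⊗ w) ⊗_) t⁻¹t) (⊗-identityʳ (u ⊕ −1F ⊗ w)))) ⟩
        w ⊕ (u ⊕ −1F ⊗ w)               ≡⟨ solve 3 (λ w u m → w :+ (u :+ m) := (w :+ m) :+ u) refl w u (−1F ⊗ w) ⟩
        (w ⊕ −1F ⊗ w) ⊕ u               ≡⟨ cong (_⊕ u) (⊕-inverse w) ⟩
        0F ⊕ u                          ≡⟨ ⊕-identityˡ u ⟩
        u ∎
      τσ : ∀ s → (w ⊕ s ⊗ t ⊕ −1F ⊗ w) ⊗ t⁻¹ ≡ s
      τσ s = begin
        (w ⊕ s ⊗ t ⊕ −1F ⊗ w) ⊗ t⁻¹
          ≡⟨ solve 5 (λ w s t m i → (w :+ s :* t :+ m) :* i := (w :+ m) :* i :+ s :* (i :* t)) refl w s t (−1F ⊗ w) t⁻¹ ⟩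
        (w ⊕ −1F ⊗ w) ⊗ t⁻¹ ⊕ s ⊗ (t⁻¹ ⊗ t)
          ≡⟨ cong₂ (λ x y → x ⊗ t⁻¹ ⊕ s ⊗ y) (⊕-inverse w) t⁻¹t ⟩
        0F ⊗ t⁻¹ ⊕ s ⊗ 1F
          ≡⟨ cong₂ _⊕_ (⊗-zeroˡ t⁻¹) (⊗-identityʳ s) ⟩
        0F ⊕ s
          ≡⟨ ⊕-identityˡ s ⟩
        s ∎

    -- Orthogonality on the whole space, by `∑e-affine` in each coordinate. The shift w is arbitrary
    -- so that the induction hypothesis can absorb the term of the first coordinate.
    ∑e-dot : ∀ {n} w (v : V n) → ∑ (allVecs q n) (λ c → e (w ⊕ c ∙ v)) ≡ ⟦ v ≟V 0V ⟧ * (N n * e w)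
    ∑e-dot w [] = begin
      e (w ⊕ 0F) + 0ℤ   ≡⟨ +-identityʳ _ ⟩
      e (w ⊕ 0F)        ≡⟨ cong e (⊕-identityʳ w) ⟩
      e w               ≡⟨ trans (*-identityˡ (1ℤ * e w)) (*-identityˡ (e w)) ⟨
      1ℤ * (1ℤ * e w) ∎
      where open ≡-Reasoning
    ∑e-dot {suc n} w (v ∷ vs) = begin
      ∑ (allVecs q (suc n)) (λ c → e (w ⊕ c ∙ (v ∷ vs)))
        ≡⟨ ∑-allVecs n _ ⟩
      ∑ (allFin q) (λ c → ∑ (allVecs q n) (λ cs → e (w ⊕ (c ⊗ v ⊕ cs ∙ vs))))
        ≡⟨ ∑-cong (allFin q) (λ c → trans
             (∑-cong (allVecs q n) (λ cs → cong e (sym (⊕-assoc w (c ⊗ v) (cs ∙ vs)))))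
             (∑e-dot (w ⊕ c ⊗ v) vs)) ⟩
      ∑ (allFin q) (λ c → ⟦ vs ≟V 0V ⟧ * (N n * e (w ⊕ c ⊗ v)))
        ≡⟨ trans (∑-*ˡ (allFin q) ⟦ vs ≟V 0V ⟧ _) (cong (⟦ vs ≟V 0V ⟧ *_)
             (trans (∑-*ˡ (allFin q) (N n) (λ c → e (w ⊕ c ⊗ v))) (cong (N n *_) (∑e-affine w v)))) ⟩
      ⟦ vs ≟V 0V ⟧ * (N n * (⟦ v ≟F 0F ⟧ * (Q * e w)))
        ≡⟨ rearrange ⟦ vs ≟V 0V ⟧ (N n) ⟦ v ≟F 0F ⟧ Q (e w) ⟩
      ⟦ v ≟F 0F ⟧ * ⟦ vs ≟V 0V ⟧ * (Q * N n * e w)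
        ≡⟨ cong₂ (λ x y → x * (y * e w)) (⟦∷⟧ v 0F vs 0V) (pos-* q (q ℕ.^ n)) ⟨
      ⟦ (v ∷ vs) ≟V 0V ⟧ * (N (suc n) * e w) ∎
      where
      open ≡-Reasoning
      rearrange : ∀ a n b q e → a * (n * (b * (q * e))) ≡ b * a * (q * n * e)
      rearrange = solve-∀

    -- The case w = 0 of `∑e-dot`, with `e` unfolded to Q times an indicator minus 1.
    hyperplane : ∀ {n} (v : V n) → v ≢ 0V → Q * ∑ (allVecs q n) (λ x → ⟦ (x ∙ v) ≟F 0F ⟧) ≡ N n
    hyperplane {n} v v≢0 = i-j≡0⇒i≡j _ _ (begin
      Q * ∑ (allVecs q n) (λ x → ⟦ (x ∙ v) ≟F 0F ⟧) - N n
        ≡⟨ cong₂ _-_ (∑-*ˡ (allVecs q n) Q (λ x → ⟦ (x ∙ v) ≟F 0F ⟧))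
             (trans (∑V-const n 1ℤ) (*-identityʳ (N n))) ⟨
      ∑ (allVecs q n) (λ x → Q * ⟦ (x ∙ v) ≟F 0F ⟧) - ∑ (allVecs q n) (λ _ → 1ℤ)
        ≡⟨ ∑-minus (allVecs q n) (λ x → Q * ⟦ (x ∙ v) ≟F 0F ⟧) (λ _ → 1ℤ) ⟨
      ∑ (allVecs q n) (λ x → e (x ∙ v))
        ≡⟨ ∑-cong (allVecs q n) (λ x → cong e (⊕-identityˡ (x ∙ v))) ⟨
      ∑ (allVecs q n) (λ x → e (0F ⊕ x ∙ v))
        ≡⟨ ∑e-dot 0F v ⟩
      ⟦ v ≟V 0V ⟧ * (N n * e 0F)
        ≡⟨ cong (_* (N n * e 0F)) (⟦⟧-no (v ≟V 0V) v≢0) ⟩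
      0ℤ ∎)
      where open ≡-Reasoning

    N>0 : ∀ n → 0ℤ < N n
    N>0 n = +<+ (ℕ.m^n>0 q n)

  ∑-swap₃ : {A B C : Set} (xs : List A) (ys : List B) (zs : List C) (G : A → B → C → ℤ) →
    ∑ xs (λ x → ∑ ys (λ y → ∑ zs (G x y))) ≡ ∑ ys (λ y → ∑ zs (λ z → ∑ xs (λ x → G x y z)))
  ∑-swap₃ xs ys zs G =
    trans (∑-swap xs ys (λ x y → ∑ zs (G x y))) (∑-cong ys (λ y → ∑-swap xs zs (λ x z → G x y z)))

  ∑∑-cong : {A B : Set} (xs : List A) (ys : List B) {G H : A → B → ℤ} → (∀ x y → G x y ≡ H x y) →
    ∑ xs (λ x → ∑ ys (G x)) ≡ ∑ xs (λ x → ∑ ys (H x))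
  ∑∑-cong xs ys eq = ∑-cong xs (λ x → ∑-cong ys (eq x))

  ∑∑-*ˡ : {A B : Set} (xs : List A) (ys : List B) (c : ℤ) (G : A → B → ℤ) →
    ∑ xs (λ x → ∑ ys (λ y → c * G x y)) ≡ c * ∑ xs (λ x → ∑ ys (G x))
  ∑∑-*ˡ xs ys c G = trans (∑-cong xs (λ x → ∑-*ˡ ys c (G x))) (∑-*ˡ xs c (λ x → ∑ ys (G x)))

  -- Moments of the deviations and the decoding inequality.

  module Moments (q : ℕ) .{{_ : NonZero q}} (pr : Prime q) where

    open Residues q
    open Field pr
    open Vectors q pr
    open SemiringSolver commutativeSemiring using (solve; _:+_; _:*_; _:=_)

    r : ℤ
    r = Q - 1ℤ

    r>0 : 0ℤ < r
    r>0 = subst (0ℤ <_) (sym (⊖-≥ (ℕ.<⇒≤ 1<q))) (+<+ (ℕ.m<n⇒0<n∸m 1<q))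
      where
      1<q : 1 ℕ.< q
      1<q = ℕ.nonTrivial⇒n>1 q {{prime⇒nonTrivial pr}}

    e-0 : e 0F ≡ r
    e-0 = cong (_- 1ℤ) (trans (cong (Q *_) (⟦⟧-yes (0F ≟F 0F) refl)) (*-identityʳ Q))

    −1F⊗-zero : ∀ t → −1F ⊗ t ≡ 0F → t ≡ 0F
    −1F⊗-zero t eq = begin
      t                ≡⟨ ⊕-identityʳ t ⟨
      t ⊕ 0F           ≡⟨ cong (t ⊕_) eq ⟨
      t ⊕ −1F ⊗ t      ≡⟨ ⊕-inverse t ⟩
      0F ∎
      where open ≡-Reasoning

    e-neg : ∀ t → e (−1F ⊗ t) ≡ e t
    e-neg t = cong (λ z → Q * z - 1ℤ) (⟦⟧-cong ((−1F ⊗ t) ≟F 0F) (t ≟F 0F) (−1F⊗-zero t)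
      (λ { refl → ⊗-zeroʳ −1F }))

    -- χ is the indicator of the set A: idempotence in ℤ forces the values 0 and 1. It is
    -- instantiated with the whole space and with A₁.
    module Weighted (d : ℕ) (χ : V d → ℤ)
      (χ-idem : ∀ x → χ x * χ x ≡ χ x) (χ-scale : ∀ s x → s ≢ 0F → χ (s ⊡ x) ≡ χ x) where

      ∑V : (V d → ℤ) → ℤ
      ∑V = ∑ (allVecs q d)

      a : ℤ
      a = ∑V χ

      τ : ℤ
      τ = ∑V (λ x → ∑V (λ y → χ x * (χ y * χ (x ⊞ y))))

      Nd : ℤ
      Nd = N d

      W : ℤ
      W = r * r * Nd

      W>0 : 0ℤ < W
      W>0 = ·-pos (·-pos r>0 r>0) (N>0 d)

      χ≥0 : ∀ x → 0ℤ ≤ χ x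
      χ≥0 x = subst (0ℤ ≤_) (χ-idem x) (sq≥0 (χ x))

      χ≤1 : ∀ x → χ x ≤ 1ℤ
      χ≤1 x = gap-by (sq≥0 (1ℤ - χ x))
        (trans (cong (λ u → 1ℤ - u) (sym (twice (χ-idem x)))) (id (χ x)))
        where
        twice : ∀ {t} → t * t ≡ t → t + t - t * t ≡ t
        twice {t} eq = trans (cong (λ u → t + t - u) eq) (id′ t)
          where
          id′ : ∀ t → t + t - t ≡ t
          id′ = solve-∀
        id : ∀ t → 1ℤ - (t + t - t * t) ≡ (1ℤ - t) * (1ℤ - t)
        id = solve-∀

      a≥0 : 0ℤ ≤ a
      a≥0 = ∑≥0 (allVecs q d) χ≥0

      module Homogeneous (k : V d → F) (k-hom : ∀ s x → k (s ⊡ x) ≡ s ⊗ k x) (w : F) where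

        T : F → ℤ
        T s = ∑V (λ x → χ x * e (w ⊕ s ⊗ k x))

        -- The substitution x ↦ s x permutes the support of χ and turns k x into s k x.
        T-scale : ∀ s → s ≢ 0F → T s ≡ T 1F
        T-scale s s≢0 with inverse s s≢0
        ... | s⁻¹ , s⁻¹s = trans
          (∑-cong (allVecs q d) (λ x → cong₂ _*_ (sym (χ-scale s x s≢0))
            (cong (λ t → e (w ⊕ t)) (sym (trans (⊗-identityˡ (k (s ⊡ x))) (k-hom s x))))))
          (∑-reindex (vectorEnumeration d) (s ⊡_) (s⁻¹ ⊡_)
            (λ x → trans (⊡-assoc s s⁻¹ x) (trans (cong (_⊡ x) (trans (⊗-comm s s⁻¹) s⁻¹s)) (⊡-identity x)))
            (λ x → trans (⊡-assoc s⁻¹ s x) (trans (cong (_⊡ x) s⁻¹s) (⊡-identity x)))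
            (λ x → χ x * e (w ⊕ 1F ⊗ k x)))

        T-zero : T 0F ≡ a * e w
        T-zero = trans
          (∑-cong (allVecs q d) (λ x → cong (λ t → χ x * e t)
            (trans (cong (w ⊕_) (⊗-zeroˡ (k x))) (⊕-identityʳ w))))
          (∑-*ʳ (allVecs q d) χ (e w))

        T-all : ∀ s → T s ≡ T 1F + ⟦ s ≟F 0F ⟧ * (a * e w - T 1F)
        T-all s with s ≟F 0F
        ... | yes refl = trans T-zero (id (a * e w) (T 1F))
          where
          id : ∀ x t → x ≡ t + 1ℤ * (x - t)
          id = solve-∀
        ... | no s≢0 = trans (T-scale s s≢0) (sym (+-identityʳ (T 1F)))

        ∑T : ∑ (allFin q) T ≡ ∑V (λ x → χ x * ⟦ k x ≟F 0F ⟧) * (Q * e w)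
        ∑T = begin
          ∑ (allFin q) T
            ≡⟨ ∑-swap (allFin q) (allVecs q d) (λ s x → χ x * e (w ⊕ s ⊗ k x)) ⟩
          ∑V (λ x → ∑ (allFin q) (λ s → χ x * e (w ⊕ s ⊗ k x)))
            ≡⟨ ∑-cong (allVecs q d) (λ x → trans (∑-*ˡ (allFin q) (χ x) (λ s → e (w ⊕ s ⊗ k x)))
                 (trans (cong (χ x *_) (∑e-affine w (k x))) (sym (*-assoc (χ x) ⟦ k x ≟F 0F ⟧ (Q * e w))))) ⟩
          ∑V (λ x → χ x * ⟦ k x ≟F 0F ⟧ * (Q * e w))
            ≡⟨ ∑-*ʳ (allVecs q d) (λ x → χ x * ⟦ k x ≟F 0F ⟧) (Q * e w) ⟩
          ∑V (λ x → χ x * ⟦ k x ≟F 0F ⟧) * (Q * e w) ∎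
          where open ≡-Reasoning

        -- A second evaluation of the same sum: `∑T` uses orthogonality in s, this one that all T s
        -- with s ≠ 0 coincide. Equating the two gives `eigen`.
        ∑T′ : ∑ (allFin q) T ≡ Q * T 1F + (a * e w - T 1F)
        ∑T′ = trans (∑-cong (allFin q) T-all)
          (trans (∑-+ (allFin q) (λ _ → T 1F) (λ s → ⟦ s ≟F 0F ⟧ * (a * e w - T 1F)))
            (cong₂ _+_ (∑F-const (T 1F))
              (Enumeration.sift fieldEnumeration 0F (λ _ → a * e w - T 1F))))

        -- As x ranges over the support of χ, k x takes all nonzero values equally often,
        -- so averaging a character over it only rescales the character.
        eigen : ∀ s → s ≢ 0F →
          (Q * ∑V (λ x → χ x * ⟦ k x ≟F 0F ⟧) - a) * e w ≡ r * T s
        eigen s s≢0 = begin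
          (Q * B - a) * e w                          ≡⟨ id₁ Q B a (e w) ⟩
          B * (Q * e w) - a * e w                    ≡⟨ cong (_- a * e w) (trans (sym ∑T) ∑T′) ⟩
          Q * T 1F + (a * e w - T 1F) - a * e w      ≡⟨ id₂ Q (T 1F) (a * e w) ⟩
          r * T 1F                                   ≡⟨ cong (r *_) (T-scale s s≢0) ⟨
          r * T s ∎
          where
          open ≡-Reasoning
          B = ∑V (λ x → χ x * ⟦ k x ≟F 0F ⟧)
          id₁ : ∀ q b a e → (q * b - a) * e ≡ b * (q * e) - a * e
          id₁ = solve-∀
          id₂ : ∀ q t x → q * t + (x - t) - x ≡ (q - 1ℤ) * t
          id₂ = solve-∀

      module Agreement (h : V d → F) (h-hom : ∀ s x → h (s ⊡ x) ≡ s ⊗ h x) where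

        K : V d → V d → F
        K c x = c ∙ x ⊕ −1F ⊗ h x

        K-hom : ∀ c s x → K c (s ⊡ x) ≡ s ⊗ K c x
        K-hom c s x = trans (cong₂ (λ t u → t ⊕ −1F ⊗ u) (∙-⊡ c s x) (h-hom s x))
          (solve 4 (λ s m t u → s :* t :+ m :* (s :* u) := s :* (t :+ m :* u)) refl s −1F (c ∙ x) (h x))

        B : V d → ℤ
        B c = ∑V (λ x → χ x * ⟦ K c x ≟F 0F ⟧)

        E : V d → ℤ
        E c = Q * B c - a

        -- A factor E c is traded for a new summation point x of A that shifts the argument of `e`
        -- by K c x. Powers of E c thus become sums over tuples of points, starting from `e 0F`,
        -- which is r.
        E-step⁺ : ∀ c w → E c * e w ≡ r * ∑V (λ x → χ x * e (w ⊕ K c x))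
        E-step⁺ c w = trans (Homogeneous.eigen (K c) (K-hom c) w 1F 1F≢0F)
          (cong (r *_) (∑-cong (allVecs q d) (λ x → cong (λ t → χ x * e (w ⊕ t)) (⊗-identityˡ (K c x)))))

        -- The same with the opposite shift, -1 being a nonzero scalar. Signs are chosen so that
        -- summing over c isolates y = x in the square and z = x + y in the cube.
        E-step⁻ : ∀ c w → E c * e w ≡ r * ∑V (λ x → χ x * e (w ⊕ −1F ⊗ K c x))
        E-step⁻ c w = Homogeneous.eigen (K c) (K-hom c) w −1F −1F≢0F

        E-first : ∀ c → E c * e 0F ≡ r * ∑V (λ x → χ x * e (K c x))
        E-first c = trans (E-step⁺ c 0F)
          (cong (r *_) (∑-cong (allVecs q d) (λ x → cong (λ t → χ x * e t) (⊕-identityˡ (K c x)))))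

        E-step-under : ∀ c (w : V d → F) (G : F → V d → F) →
          (∀ w → E c * e w ≡ r * ∑V (λ y → χ y * e (G w y))) →
          E c * (r * ∑V (λ x → χ x * e (w x))) ≡
          r * (r * ∑V (λ x → ∑V (λ y → χ x * (χ y * e (G (w x) y)))))
        E-step-under c w G step = begin
          E c * (r * ∑V (λ x → χ x * e (w x)))
            ≡⟨ id (E c) r (∑V (λ x → χ x * e (w x))) ⟩
          r * (E c * ∑V (λ x → χ x * e (w x)))
            ≡⟨ cong (r *_) (∑-*ˡ (allVecs q d) (E c) (λ x → χ x * e (w x))) ⟨
          r * ∑V (λ x → E c * (χ x * e (w x)))
            ≡⟨ cong (r *_) (∑-cong (allVecs q d) (λ x → trans (id (E c) (χ x) (e (w x)))
                 (trans (cong (χ x *_) (step (w x))) (id (χ x) r (∑V (λ y → χ y * e (G (w x) y))))))) ⟩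
          r * ∑V (λ x → r * (χ x * ∑V (λ y → χ y * e (G (w x) y))))
            ≡⟨ cong (r *_) (trans (∑-*ˡ (allVecs q d) r (λ x → χ x * ∑V (λ y → χ y * e (G (w x) y))))
                 (cong (r *_) (∑-cong (allVecs q d) (λ x →
                   sym (∑-*ˡ (allVecs q d) (χ x) (λ y → χ y * e (G (w x) y))))))) ⟩
          r * (r * ∑V (λ x → ∑V (λ y → χ x * (χ y * e (G (w x) y))))) ∎
          where
          open ≡-Reasoning
          id : ∀ e r s → e * (r * s) ≡ r * (e * s)
          id = solve-∀

        D : V d → V d → F
        D x y = h x ⊕ h y ⊕ −1F ⊗ h (x ⊞ y)

        τ⁰ : ℤ
        τ⁰ = ∑V (λ x → ∑V (λ y → χ x * (χ y * (χ (x ⊞ y) * ⟦ D x y ≟F 0F ⟧))))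

        square-expand : ∀ c → E c * (E c * e 0F) ≡
          r * (r * ∑V (λ x → ∑V (λ y → χ x * (χ y * e (K c x ⊕ −1F ⊗ K c y)))))
        square-expand c = trans (cong (E c *_) (E-first c))
          (E-step-under c (K c) (λ w y → w ⊕ −1F ⊗ K c y) (E-step⁻ c))

        -- The argument is affine in c with slope x - y, so orthogonality leaves only y = x, where
        -- the constant term w vanishes as well.
        ∑-e-difference : ∀ x y →
          ∑V (λ c → χ x * (χ y * e (K c x ⊕ −1F ⊗ K c y))) ≡ ⟦ y ≟V x ⟧ * (χ x * (χ y * (Nd * r)))
        ∑-e-difference x y = begin
          ∑V (λ c → χ x * (χ y * e (K c x ⊕ −1F ⊗ K c y)))
            ≡⟨ trans (∑-*ˡ (allVecs q d) (χ x) (λ c → χ y * e (K c x ⊕ −1F ⊗ K c y)))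
                 (cong (χ x *_) (∑-*ˡ (allVecs q d) (χ y) (λ c → e (K c x ⊕ −1F ⊗ K c y)))) ⟩
          χ x * (χ y * ∑V (λ c → e (K c x ⊕ −1F ⊗ K c y)))
            ≡⟨ cong (λ t → χ x * (χ y * t)) (trans (∑-cong (allVecs q d) (λ c → cong e (collect c)))
                 (∑e-dot w (x ⊞ −1F ⊡ y))) ⟩
          χ x * (χ y * (⟦ (x ⊞ −1F ⊡ y) ≟V 0V ⟧ * (Nd * e w)))
            ≡⟨ cong (λ t → χ x * (χ y * (t * (Nd * e w))))
                 (⟦⟧-cong ((x ⊞ −1F ⊡ y) ≟V 0V) (y ≟V x)
                   (λ eq → sym (⊞-cancel x y eq)) (λ { refl → ⊞-inverse x })) ⟩
          χ x * (χ y * (⟦ y ≟V x ⟧ * (Nd * e w)))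
            ≡⟨ diagonal ⟩
          ⟦ y ≟V x ⟧ * (χ x * (χ y * (Nd * r))) ∎
          where
          open ≡-Reasoning
          w : F
          w = −1F ⊗ (h x ⊕ −1F ⊗ h y)
          collect : ∀ c → K c x ⊕ −1F ⊗ K c y ≡ w ⊕ c ∙ (x ⊞ −1F ⊡ y)
          collect c = trans
            (solve 5 (λ m s t u v → s :+ m :* u :+ m :* (t :+ m :* v) := m :* (u :+ m :* v) :+ (s :+ m :* t))
              refl −1F (c ∙ x) (c ∙ y) (h x) (h y))
            (cong (w ⊕_) (sym (trans (∙-⊞ c x (−1F ⊡ y)) (cong (c ∙ x ⊕_) (∙-⊡ c −1F y)))))
          diagonal : χ x * (χ y * (⟦ y ≟V x ⟧ * (Nd * e w))) ≡ ⟦ y ≟V x ⟧ * (χ x * (χ y * (Nd * r)))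
          diagonal with y ≟V x
          ... | no _ = trans (cong (χ x *_) (*-zeroʳ (χ y))) (*-zeroʳ (χ x))
          ... | yes refl = trans
            (cong (λ t → χ x * (χ x * (1ℤ * (Nd * t))))
              (trans (cong e (trans (cong (−1F ⊗_) (⊕-inverse (h x))) (⊗-zeroʳ −1F))) e-0))
            (id (χ x) (Nd * r))
            where
            id : ∀ c n → c * (c * (1ℤ * n)) ≡ 1ℤ * (c * (c * n))
            id = solve-∀

        ∑E²e : ∑V (λ c → E c * (E c * e 0F)) ≡ r * (r * (a * (Nd * r)))
        ∑E²e = begin
          ∑V (λ c → E c * (E c * e 0F))
            ≡⟨ ∑-cong (allVecs q d) square-expand ⟩
          ∑V (λ c → r * (r * ∑V (λ x → ∑V (λ y → χ x * (χ y * e (K c x ⊕ −1F ⊗ K c y))))))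
            ≡⟨ trans (∑-*ˡ (allVecs q d) r _) (cong (r *_) (∑-*ˡ (allVecs q d) r _)) ⟩
          r * (r * ∑V (λ c → ∑V (λ x → ∑V (λ y → χ x * (χ y * e (K c x ⊕ −1F ⊗ K c y))))))
            ≡⟨ cong (λ t → r * (r * t)) (trans
                 (∑-swap₃ (allVecs q d) (allVecs q d) (allVecs q d)
                   (λ c x y → χ x * (χ y * e (K c x ⊕ −1F ⊗ K c y))))
                 (∑∑-cong (allVecs q d) (allVecs q d) ∑-e-difference)) ⟩
          r * (r * ∑V (λ x → ∑V (λ y → ⟦ y ≟V x ⟧ * (χ x * (χ y * (Nd * r))))))
            ≡⟨ cong (λ t → r * (r * t)) (trans
                 (∑-cong (allVecs q d) (λ x → trans (vectors-sift x (λ y → χ x * (χ y * (Nd * r))))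
                   (trans (sym (*-assoc (χ x) (χ x) (Nd * r))) (cong (_* (Nd * r)) (χ-idem x)))))
                 (∑-*ʳ (allVecs q d) χ (Nd * r))) ⟩
          r * (r * (a * (Nd * r))) ∎
          where open ≡-Reasoning

        -- Parseval for the deviations; the extra factor r on both sides is the initial `e 0F`.
        second-moment : ∑V (λ c → E c * E c) ≡ r * r * (Nd * a)
        second-moment = ·-cancel-≡ r>0 (begin
          r * ∑V (λ c → E c * E c)
            ≡⟨ ∑-*ˡ (allVecs q d) r (λ c → E c * E c) ⟨
          ∑V (λ c → r * (E c * E c))
            ≡⟨ ∑-cong (allVecs q d) (λ c → trans (id₁ r (E c)) (cong (λ t → E c * (E c * t)) (sym e-0))) ⟩
          ∑V (λ c → E c * (E c * e 0F))
            ≡⟨ ∑E²e ⟩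
          r * (r * (a * (Nd * r)))
            ≡⟨ id₂ r a Nd ⟩
          r * (r * r * (Nd * a)) ∎)
          where
          open ≡-Reasoning
          id₁ : ∀ r e → r * (e * e) ≡ e * (e * r)
          id₁ = solve-∀
          id₂ : ∀ r a n → r * (r * (a * (n * r))) ≡ r * (r * r * (n * a))
          id₂ = solve-∀

        -- Both shifts are positive here, in preparation for a third factor with negative shift.
        square-expand′ : ∀ c → E c * (E c * e 0F) ≡
          r * (r * ∑V (λ x → ∑V (λ y → χ x * (χ y * e (K c x ⊕ K c y)))))
        square-expand′ c = trans (cong (E c *_) (E-first c))
          (E-step-under c (K c) (λ w y → w ⊕ K c y) (E-step⁺ c))

        cube-expand : ∀ c → E c * (E c * (E c * e 0F)) ≡ r * (r * (r * ∑V (λ x → ∑V (λ y → ∑V (λ z →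
          χ x * (χ y * (χ z * e (K c x ⊕ K c y ⊕ −1F ⊗ K c z))))))))
        cube-expand c = begin
          E c * (E c * (E c * e 0F))
            ≡⟨ cong (E c *_) (square-expand′ c) ⟩
          E c * (r * (r * ∑V (λ x → ∑V (λ y → χ x * (χ y * e (K c x ⊕ K c y))))))
            ≡⟨ id (E c) r (∑V (λ x → ∑V (λ y → χ x * (χ y * e (K c x ⊕ K c y))))) ⟩
          r * (r * (E c * ∑V (λ x → ∑V (λ y → χ x * (χ y * e (K c x ⊕ K c y))))))
            ≡⟨ cong (λ t → r * (r * t)) (sym (∑∑-*ˡ (allVecs q d) (allVecs q d) (E c)
                 (λ x y → χ x * (χ y * e (K c x ⊕ K c y))))) ⟩
          r * (r * ∑V (λ x → ∑V (λ y → E c * (χ x * (χ y * e (K c x ⊕ K c y))))))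
            ≡⟨ cong (λ t → r * (r * t)) (trans (∑∑-cong (allVecs q d) (allVecs q d) step)
                 (∑∑-*ˡ (allVecs q d) (allVecs q d) r
                   (λ x y → ∑V (λ z → χ x * (χ y * (χ z * e (K c x ⊕ K c y ⊕ −1F ⊗ K c z))))))) ⟩
          r * (r * (r * ∑V (λ x → ∑V (λ y → ∑V (λ z →
            χ x * (χ y * (χ z * e (K c x ⊕ K c y ⊕ −1F ⊗ K c z)))))))) ∎
          where
          open ≡-Reasoning
          id : ∀ e r s → e * (r * (r * s)) ≡ r * (r * (e * s))
          id = solve-∀
          id₁ : ∀ e x y s → e * (x * (y * s)) ≡ x * (y * (e * s))
          id₁ = solve-∀
          id₂ : ∀ x y r s → x * (y * (r * s)) ≡ r * (x * (y * s))
          id₂ = solve-∀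
          step : ∀ x y → E c * (χ x * (χ y * e (K c x ⊕ K c y))) ≡
            r * ∑V (λ z → χ x * (χ y * (χ z * e (K c x ⊕ K c y ⊕ −1F ⊗ K c z))))
          step x y = begin
            E c * (χ x * (χ y * e (K c x ⊕ K c y)))
              ≡⟨ id₁ (E c) (χ x) (χ y) (e (K c x ⊕ K c y)) ⟩
            χ x * (χ y * (E c * e (K c x ⊕ K c y)))
              ≡⟨ cong (λ t → χ x * (χ y * t)) (E-step⁻ c (K c x ⊕ K c y)) ⟩
            χ x * (χ y * (r * ∑V S))
              ≡⟨ id₂ (χ x) (χ y) r (∑V S) ⟩
            r * (χ x * (χ y * ∑V S))
              ≡⟨ cong (r *_) (sym (trans (∑-*ˡ (allVecs q d) (χ x) (λ z → χ y * S z))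
                   (cong (χ x *_) (∑-*ˡ (allVecs q d) (χ y) S)))) ⟩
            r * ∑V (λ z → χ x * (χ y * S z)) ∎
            where
            S : V d → ℤ
            S z = χ z * e (K c x ⊕ K c y ⊕ −1F ⊗ K c z)

        -- The slope in c is x + y - z, so only z = x + y survives. Since `e` is even, what remains
        -- is `e (D x y)`: r for an accepted pair, -1 for a rejected one.
        ∑-e-triple : ∀ x y z → ∑V (λ c → χ x * (χ y * (χ z * e (K c x ⊕ K c y ⊕ −1F ⊗ K c z)))) ≡
          ⟦ z ≟V (x ⊞ y) ⟧ * (χ x * (χ y * (χ z * (Nd * e (h x ⊕ h y ⊕ −1F ⊗ h z)))))
        ∑-e-triple x y z = begin
          ∑V (λ c → χ x * (χ y * (χ z * e (K c x ⊕ K c y ⊕ −1F ⊗ K c z))))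
            ≡⟨ trans (∑-*ˡ (allVecs q d) (χ x) _) (cong (χ x *_) (trans (∑-*ˡ (allVecs q d) (χ y) _)
                 (cong (χ y *_) (∑-*ˡ (allVecs q d) (χ z) (λ c → e (K c x ⊕ K c y ⊕ −1F ⊗ K c z)))))) ⟩
          χ x * (χ y * (χ z * ∑V (λ c → e (K c x ⊕ K c y ⊕ −1F ⊗ K c z))))
            ≡⟨ cong (λ t → χ x * (χ y * (χ z * t))) (trans (∑-cong (allVecs q d) (λ c → cong e (collect c)))
                 (∑e-dot (−1F ⊗ w) (x ⊞ y ⊞ −1F ⊡ z))) ⟩
          χ x * (χ y * (χ z * (⟦ (x ⊞ y ⊞ −1F ⊡ z) ≟V 0V ⟧ * (Nd * e (−1F ⊗ w)))))
            ≡⟨ cong₂ (λ t u → χ x * (χ y * (χ z * (t * (Nd * u)))))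
                 (⟦⟧-cong ((x ⊞ y ⊞ −1F ⊡ z) ≟V 0V) (z ≟V (x ⊞ y))
                   (λ eq → sym (⊞-cancel (x ⊞ y) z eq)) (λ { refl → ⊞-inverse (x ⊞ y) }))
                 (e-neg w) ⟩
          χ x * (χ y * (χ z * (⟦ z ≟V (x ⊞ y) ⟧ * (Nd * e w))))
            ≡⟨ id (χ x) (χ y) (χ z) ⟦ z ≟V (x ⊞ y) ⟧ (Nd * e w) ⟩
          ⟦ z ≟V (x ⊞ y) ⟧ * (χ x * (χ y * (χ z * (Nd * e w)))) ∎
          where
          open ≡-Reasoning
          id : ∀ x y z i t → x * (y * (z * (i * t))) ≡ i * (x * (y * (z * t)))
          id = solve-∀
          w : F
          w = h x ⊕ h y ⊕ −1F ⊗ h z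
          collect : ∀ c → K c x ⊕ K c y ⊕ −1F ⊗ K c z ≡ −1F ⊗ w ⊕ c ∙ (x ⊞ y ⊞ −1F ⊡ z)
          collect c = trans
            (solve 7 (λ m a b c x y z → (a :+ m :* x) :+ (b :+ m :* y) :+ m :* (c :+ m :* z) :=
                       m :* (x :+ y :+ m :* z) :+ (a :+ b :+ m :* c))
              refl −1F (c ∙ x) (c ∙ y) (c ∙ z) (h x) (h y) (h z))
            (cong (−1F ⊗ w ⊕_) (sym (trans (∙-⊞ c (x ⊞ y) (−1F ⊡ z)) (cong₂ _⊕_ (∙-⊞ c x y) (∙-⊡ c −1F z)))))

        ∑E³e : ∑V (λ c → E c * (E c * (E c * e 0F))) ≡ r * (r * (r * (Nd * (Q * τ⁰ - τ))))
        ∑E³e = begin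
          ∑V (λ c → E c * (E c * (E c * e 0F)))
            ≡⟨ ∑-cong (allVecs q d) cube-expand ⟩
          ∑V (λ c → r * (r * (r * ∑V (λ x → ∑V (λ y → ∑V (λ z → G c x y z))))))
            ≡⟨ trans (∑-*ˡ (allVecs q d) r _) (cong (r *_) (trans (∑-*ˡ (allVecs q d) r _)
                 (cong (r *_) (∑-*ˡ (allVecs q d) r (λ c → ∑V (λ x → ∑V (λ y → ∑V (λ z → G c x y z)))))))) ⟩
          r * (r * (r * ∑V (λ c → ∑V (λ x → ∑V (λ y → ∑V (λ z → G c x y z))))))
            ≡⟨ cong (λ t → r * (r * (r * t))) (trans
                 (∑-swap₃ (allVecs q d) (allVecs q d) (allVecs q d) (λ c x y → ∑V (λ z → G c x y z)))
                 (∑∑-cong (allVecs q d) (allVecs q d) (λ x y → trans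
                   (∑-swap (allVecs q d) (allVecs q d) (λ c z → G c x y z))
                   (trans (∑-cong (allVecs q d) (∑-e-triple x y))
                     (trans (vectors-sift (x ⊞ y)
                              (λ z → χ x * (χ y * (χ z * (Nd * e (h x ⊕ h y ⊕ −1F ⊗ h z))))))
                       (id Nd Q (χ x) (χ y) (χ (x ⊞ y)) ⟦ D x y ≟F 0F ⟧)))))) ⟩
          r * (r * (r * ∑V (λ x → ∑V (λ y → Nd * (Q * Y x y - Z x y)))))
            ≡⟨ cong (λ t → r * (r * (r * t))) (trans
                 (∑∑-*ˡ (allVecs q d) (allVecs q d) Nd (λ x y → Q * Y x y - Z x y))
                 (cong (Nd *_) (trans
                   (∑-cong (allVecs q d) (λ x → trans (∑-minus (allVecs q d) (λ y → Q * Y x y) (Z x))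
                     (cong (_- ∑V (Z x)) (∑-*ˡ (allVecs q d) Q (Y x)))))
                   (trans (∑-minus (allVecs q d) (λ x → Q * ∑V (Y x)) (λ x → ∑V (Z x)))
                     (cong (_- τ) (∑-*ˡ (allVecs q d) Q (λ x → ∑V (Y x)))))))) ⟩
          r * (r * (r * (Nd * (Q * τ⁰ - τ)))) ∎
          where
          open ≡-Reasoning
          G : V d → V d → V d → V d → ℤ
          G c x y z = χ x * (χ y * (χ z * e (K c x ⊕ K c y ⊕ −1F ⊗ K c z)))
          Y Z : V d → V d → ℤ
          Y x y = χ x * (χ y * (χ (x ⊞ y) * ⟦ D x y ≟F 0F ⟧))
          Z x y = χ x * (χ y * χ (x ⊞ y))
          id : ∀ n q x y z i →
            x * (y * (z * (n * (q * i - 1ℤ)))) ≡ n * (q * (x * (y * (z * i))) - x * (y * z))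
          id = solve-∀

        third-moment : ∑V (λ c → E c * (E c * E c)) ≡ r * r * (Nd * (Q * τ⁰ - τ))
        third-moment = ·-cancel-≡ r>0 (begin
          r * ∑V (λ c → E c * (E c * E c))
            ≡⟨ ∑-*ˡ (allVecs q d) r (λ c → E c * (E c * E c)) ⟨
          ∑V (λ c → r * (E c * (E c * E c)))
            ≡⟨ ∑-cong (allVecs q d) (λ c → trans (id₁ r (E c)) (cong (λ t → E c * (E c * (E c * t))) (sym e-0))) ⟩
          ∑V (λ c → E c * (E c * (E c * e 0F)))
            ≡⟨ ∑E³e ⟩
          r * (r * (r * (Nd * (Q * τ⁰ - τ))))
            ≡⟨ id₂ r (Nd * (Q * τ⁰ - τ)) ⟩
          r * (r * r * (Nd * (Q * τ⁰ - τ))) ∎)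
          where
          open ≡-Reasoning
          id₁ : ∀ r e → r * (e * (e * e)) ≡ e * (e * (e * r))
          id₁ = solve-∀
          id₂ : ∀ r t → r * (r * (r * t)) ≡ r * (r * r * t)
          id₂ = solve-∀

        -- This is Q `S₂` / W: by Q B = E + a, the third moment plus a times the second, without
        -- their common factor W.
        R : ℤ
        R = Q * τ⁰ - τ + a * a

        B≥0 : ∀ c → 0ℤ ≤ B c
        B≥0 c = ∑≥0 (allVecs q d) (λ x → χ≥0 x ·≥ ⟦⟧≥0 (K c x ≟F 0F))

        B≤a : ∀ c → B c ≤ a
        B≤a c = ∑-mono (allVecs q d) (λ x →
          subst (χ x * ⟦ K c x ≟F 0F ⟧ ≤_) (*-identityʳ (χ x)) (·-monoˡ (χ≥0 x) (⟦⟧≤1 (K c x ≟F 0F))))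

        E²≥0 : ∀ c → 0ℤ ≤ E c * E c
        E²≥0 c = sq≥0 (E c)

        S₂ : ℤ
        S₂ = ∑V (λ c → E c * E c * B c)

        S₂≥0 : 0ℤ ≤ S₂
        S₂≥0 = ∑≥0 (allVecs q d) (λ c → E²≥0 c ·≥ B≥0 c)

        QS₂ : Q * S₂ ≡ W * R
        QS₂ = begin
          Q * S₂
            ≡⟨ ∑-*ˡ (allVecs q d) Q (λ c → E c * E c * B c) ⟨
          ∑V (λ c → Q * (E c * E c * B c))
            ≡⟨ ∑-cong (allVecs q d) (λ c → id₁ Q (B c) a) ⟩
          ∑V (λ c → E c * (E c * E c) + a * (E c * E c))
            ≡⟨ trans (∑-+ (allVecs q d) (λ c → E c * (E c * E c)) (λ c → a * (E c * E c)))
                 (cong₂ _+_ third-moment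
                   (trans (∑-*ˡ (allVecs q d) a (λ c → E c * E c)) (cong (a *_) second-moment))) ⟩
          r * r * (Nd * (Q * τ⁰ - τ)) + a * (r * r * (Nd * a))
            ≡⟨ id₂ r Nd (Q * τ⁰ - τ) a ⟩
          W * R ∎
          where
          open ≡-Reasoning
          id₁ : ∀ q b a → q * ((q * b - a) * (q * b - a) * b) ≡
            (q * b - a) * ((q * b - a) * (q * b - a)) + a * ((q * b - a) * (q * b - a))
          id₁ = solve-∀
          id₂ : ∀ r n t a → r * r * (n * t) + a * (r * r * (n * a)) ≡ r * r * n * (t + a * a)
          id₂ = solve-∀

        R≥0 : 0ℤ ≤ R
        R≥0 = ·-cancel W>0 (subst₂ _≤_ (sym (*-zeroʳ W)) QS₂ (0≤+ q ·≥ S₂≥0))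

        common : V d → V d → ℤ
        common c c′ = ∑V (λ x → χ x * (⟦ K c x ≟F 0F ⟧ * ⟦ K c′ x ≟F 0F ⟧))

        -- Points where two distinct forms both equal h lie on the hyperplane orthogonal to their
        -- difference. On the diagonal `Nd` is slack that lets the later sum over all pairs of forms
        -- factor.
        common-bound : ∀ c c′ → Q * common c c′ ≤ ⟦ c′ ≟V c ⟧ * (Q * B c) + Nd
        common-bound c c′ with c′ ≟V c
        ... | yes refl = ≤-trans
          (≤-reflexive (trans (cong (Q *_) (∑-cong (allVecs q d) (λ x → cong (χ x *_) (⟦⟧-idem (K c x ≟F 0F)))))
            (sym (*-identityˡ (Q * B c)))))
          (gap-by (0≤+ (q ℕ.^ d)) (id (1ℤ * (Q * B c)) Nd))
          where
          id : ∀ x n → x + n - x ≡ n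
          id = solve-∀
        ... | no c′≢c = ≤-trans
          (·-monoˡ (0≤+ q) (∑-mono (allVecs q d) pointwise))
          (≤-reflexive (trans (hyperplane v v≢0) (sym (+-identityˡ Nd))))
          where
          v : V d
          v = c′ ⊞ −1F ⊡ c
          v≢0 : v ≢ 0V
          v≢0 eq = c′≢c (⊞-cancel c′ c eq)
          on-hyperplane : ∀ x → K c x ≡ 0F → K c′ x ≡ 0F → x ∙ v ≡ 0F
          on-hyperplane x eq eq′ = begin
            x ∙ (c′ ⊞ −1F ⊡ c)        ≡⟨ trans (∙-⊞ x c′ (−1F ⊡ c)) (cong (x ∙ c′ ⊕_) (∙-⊡ x −1F c)) ⟩
            x ∙ c′ ⊕ −1F ⊗ x ∙ c      ≡⟨ cong₂ (λ s t → s ⊕ −1F ⊗ t) (∙-comm x c′) (∙-comm x c) ⟩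
            c′ ∙ x ⊕ −1F ⊗ c ∙ x      ≡⟨ cong₂ (λ s t → s ⊕ −1F ⊗ t) (⊕-cancel (c′ ∙ x) (h x) eq′) (⊕-cancel (c ∙ x) (h x) eq) ⟩
            h x ⊕ −1F ⊗ h x           ≡⟨ ⊕-inverse (h x) ⟩
            0F ∎
            where open ≡-Reasoning
          pointwise : ∀ x → χ x * (⟦ K c x ≟F 0F ⟧ * ⟦ K c′ x ≟F 0F ⟧) ≤ ⟦ (x ∙ v) ≟F 0F ⟧
          pointwise x with K c x ≟F 0F | K c′ x ≟F 0F
          ... | no _  | _     = subst (_≤ ⟦ (x ∙ v) ≟F 0F ⟧) (sym (*-zeroʳ (χ x))) (⟦⟧≥0 ((x ∙ v) ≟F 0F))
          ... | yes _ | no _  = subst (_≤ ⟦ (x ∙ v) ≟F 0F ⟧) (sym (*-zeroʳ (χ x))) (⟦⟧≥0 ((x ∙ v) ≟F 0F))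
          ... | yes p | yes p′ = subst₂ _≤_ (sym (*-identityʳ (χ x)))
            (sym (⟦⟧-yes ((x ∙ v) ≟F 0F) (on-hyperplane x p p′))) (χ≤1 x)

        Φ : V d → ℤ
        Φ x = ∑V (λ c → E c * E c * ⟦ K c x ≟F 0F ⟧)

        ∑χΦ : ∑V (λ x → χ x * Φ x) ≡ S₂
        ∑χΦ = begin
          ∑V (λ x → χ x * Φ x)
            ≡⟨ ∑-cong (allVecs q d) (λ x → sym (∑-*ˡ (allVecs q d) (χ x) (λ c → E c * E c * ⟦ K c x ≟F 0F ⟧))) ⟩
          ∑V (λ x → ∑V (λ c → χ x * (E c * E c * ⟦ K c x ≟F 0F ⟧)))
            ≡⟨ ∑-swap (allVecs q d) (allVecs q d) (λ x c → χ x * (E c * E c * ⟦ K c x ≟F 0F ⟧)) ⟩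
          ∑V (λ c → ∑V (λ x → χ x * (E c * E c * ⟦ K c x ≟F 0F ⟧)))
            ≡⟨ ∑-cong (allVecs q d) (λ c → trans
                 (∑-cong (allVecs q d) (λ x → id (χ x) (E c * E c) ⟦ K c x ≟F 0F ⟧))
                 (∑-*ˡ (allVecs q d) (E c * E c) (λ x → χ x * ⟦ K c x ≟F 0F ⟧))) ⟩
          S₂ ∎
          where
          open ≡-Reasoning
          id : ∀ x e i → x * (e * i) ≡ e * (x * i)
          id = solve-∀

        ∑χΦ² : ∑V (λ x → χ x * (Φ x * Φ x)) ≡
          ∑V (λ c → ∑V (λ c′ → E c * E c * (E c′ * E c′) * common c c′))
        ∑χΦ² = begin
          ∑V (λ x → χ x * (Φ x * Φ x))
            ≡⟨ ∑-cong (allVecs q d) (λ x → trans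
                 (cong (χ x *_) (∑-product (allVecs q d) (allVecs q d) (G x) (G x)))
                 (sym (∑∑-*ˡ (allVecs q d) (allVecs q d) (χ x) (λ c c′ → G x c * G x c′)))) ⟩
          ∑V (λ x → ∑V (λ c → ∑V (λ c′ → χ x * (G x c * G x c′))))
            ≡⟨ ∑-swap₃ (allVecs q d) (allVecs q d) (allVecs q d) (λ x c c′ → χ x * (G x c * G x c′)) ⟩
          ∑V (λ c → ∑V (λ c′ → ∑V (λ x → χ x * (G x c * G x c′))))
            ≡⟨ ∑∑-cong (allVecs q d) (allVecs q d) (λ c c′ → trans
                 (∑-cong (allVecs q d) (λ x → id (χ x) (E c * E c) (E c′ * E c′) ⟦ K c x ≟F 0F ⟧ ⟦ K c′ x ≟F 0F ⟧))
                 (∑-*ˡ (allVecs q d) (E c * E c * (E c′ * E c′))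
                   (λ x → χ x * (⟦ K c x ≟F 0F ⟧ * ⟦ K c′ x ≟F 0F ⟧)))) ⟩
          ∑V (λ c → ∑V (λ c′ → E c * E c * (E c′ * E c′) * common c c′)) ∎
          where
          open ≡-Reasoning
          G : V d → V d → ℤ
          G x c = E c * E c * ⟦ K c x ≟F 0F ⟧
          id : ∀ x e f i j → x * (e * i * (f * j)) ≡ e * f * (x * (i * j))
          id = solve-∀

        -- E² is maximised rather than B because it is E² that gets pulled out of the diagonal sum;
        -- `U-bound` returns to B.
        best : ∃ λ m → ∀ c → E c * E c ≤ E m * E m
        best = maximizer (vectorEnumeration d) 0V (λ c → E c * E c)

        c₀ : V d
        c₀ = proj₁ best

        U : ℤ
        U = E c₀ * E c₀

        -- On the diagonal one of the two factors E² is replaced by its maximum U, leaving Q `S₂`.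
        -- The other term of `common-bound` yields the square of the second moment.
        Q∑χΦ²-bound : Q * ∑V (λ x → χ x * (Φ x * Φ x)) ≤ U * (Q * S₂) + Nd * (W * a * (W * a))
        Q∑χΦ²-bound = begin
          Q * ∑V (λ x → χ x * (Φ x * Φ x))
            ≡⟨ trans (cong (Q *_) ∑χΦ²) (sym (∑∑-*ˡ (allVecs q d) (allVecs q d) Q
                 (λ c c′ → E c * E c * (E c′ * E c′) * common c c′))) ⟩
          ∑V (λ c → ∑V (λ c′ → Q * (E c * E c * (E c′ * E c′) * common c c′)))
            ≤⟨ ∑-mono (allVecs q d) (λ c → ∑-mono (allVecs q d) (λ c′ → pointwise c c′)) ⟩
          ∑V (λ c → ∑V (λ c′ → ⟦ c′ ≟V c ⟧ * (E c * E c * (E c′ * E c′) * (Q * B c))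
                                 + Nd * (E c * E c * (E c′ * E c′))))
            ≡⟨ ∑-cong (allVecs q d) (λ c → trans
                 (∑-+ (allVecs q d) (λ c′ → ⟦ c′ ≟V c ⟧ * (E c * E c * (E c′ * E c′) * (Q * B c)))
                   (λ c′ → Nd * (E c * E c * (E c′ * E c′))))
                 (cong (_+ ∑V (λ c′ → Nd * (E c * E c * (E c′ * E c′))))
                   (vectors-sift c (λ c′ → E c * E c * (E c′ * E c′) * (Q * B c))))) ⟩
          ∑V (λ c → E c * E c * (E c * E c) * (Q * B c) + ∑V (λ c′ → Nd * (E c * E c * (E c′ * E c′))))
            ≡⟨ ∑-+ (allVecs q d) (λ c → E c * E c * (E c * E c) * (Q * B c))
                 (λ c → ∑V (λ c′ → Nd * (E c * E c * (E c′ * E c′)))) ⟩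
          ∑V (λ c → E c * E c * (E c * E c) * (Q * B c))
            + ∑V (λ c → ∑V (λ c′ → Nd * (E c * E c * (E c′ * E c′))))
            ≤⟨ +-mono-≤
                 (∑-mono (allVecs q d) (λ c → ≤-trans
                   (≤-reflexive (id₁ (E c * E c) Q (B c)))
                   (·-mono (E²≥0 c) (proj₂ best c) (0≤+ q ·≥ E²≥0 c ·≥ B≥0 c) ≤-refl)))
                 (≤-reflexive (trans
                   (∑∑-*ˡ (allVecs q d) (allVecs q d) Nd (λ c c′ → E c * E c * (E c′ * E c′)))
                   (cong (Nd *_) (sym (∑-product (allVecs q d) (allVecs q d) (λ c → E c * E c) (λ c → E c * E c)))))) ⟩
          ∑V (λ c → U * (Q * (E c * E c * B c))) + Nd * (∑V (λ c → E c * E c) * ∑V (λ c → E c * E c))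
            ≡⟨ cong₂ _+_
                 (trans (∑-*ˡ (allVecs q d) U (λ c → Q * (E c * E c * B c)))
                   (cong (U *_) (∑-*ˡ (allVecs q d) Q (λ c → E c * E c * B c))))
                 (cong (λ t → Nd * (t * t)) (trans second-moment (sym (*-assoc (r * r) Nd a)))) ⟩
          U * (Q * S₂) + Nd * (W * a * (W * a)) ∎
          where
          open ≤-Reasoning
          id₁ : ∀ e q b → e * e * (q * b) ≡ e * (q * (e * b))
          id₁ = solve-∀
          id₂ : ∀ q e o → q * (e * o) ≡ e * (q * o)
          id₂ = solve-∀
          id₃ : ∀ e i b n → e * (i * b + n) ≡ i * (e * b) + n * e
          id₃ = solve-∀
          pointwise : ∀ c c′ → Q * (E c * E c * (E c′ * E c′) * common c c′) ≤
            ⟦ c′ ≟V c ⟧ * (E c * E c * (E c′ * E c′) * (Q * B c)) + Nd * (E c * E c * (E c′ * E c′))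
          pointwise c c′ = subst₂ _≤_
            (sym (id₂ Q (E c * E c * (E c′ * E c′)) (common c c′)))
            (id₃ (E c * E c * (E c′ * E c′)) ⟦ c′ ≟V c ⟧ (Q * B c) Nd)
            (·-monoˡ (E²≥0 c ·≥ E²≥0 c′) (common-bound c c′))

        -- A negative deviation is at least -a, so its square is at most a²; a nonnegative one is Q
        -- B - a ≤ r B because B ≤ a. The sum of the two bounds covers both cases in a single
        -- identity.
        U-bound : U ≤ r * r * (B c₀ * B c₀) + a * a
        U-bound = gap-by
          (B≥0 c₀ ·≥ (a≥0 +≥ gap (B≤a c₀)) +≥
           (<⇒≤ r>0 ·≥ B≥0 c₀ ·≥ gap (B≤a c₀)) +≥ (<⇒≤ r>0 ·≥ B≥0 c₀ ·≥ gap (B≤a c₀)))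
          (id Q (B c₀) a)
          where
          id : ∀ q b a → (q - 1ℤ) * (q - 1ℤ) * (b * b) + a * a - (q * b - a) * (q * b - a) ≡
            b * (a + (a - b)) + (q - 1ℤ) * (b * (a - b)) + (q - 1ℤ) * (b * (a - b))
          id = solve-∀

        -- Cauchy-Schwarz for Φ over A, with Q `S₂` replaced by W R and one factor W cancelled. Both
        -- agreement lemmas extract a lower bound on B c₀ from this.
        decode : W * (R * R) ≤ Q * (a * ((r * r * (B c₀ * B c₀) + a * a) * R + Nd * (W * (a * a))))
        decode = ·-cancel W>0 (begin
          W * (W * (R * R))
            ≡⟨ id₁ W R ⟩
          W * R * (W * R)
            ≡⟨ cong₂ _*_ QS₂ QS₂ ⟨
          Q * S₂ * (Q * S₂)
            ≡⟨ id₂ Q S₂ ⟩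
          Q * (Q * (S₂ * S₂))
            ≤⟨ ·-monoˡ (0≤+ q) (·-monoˡ (0≤+ q) (subst (λ t → t * t ≤ a * ∑V (λ x → χ x * (Φ x * Φ x))) ∑χΦ
                 (cauchy-schwarz (allVecs q d) χ Φ χ≥0))) ⟩
          Q * (Q * (a * ∑V (λ x → χ x * (Φ x * Φ x))))
            ≡⟨ id₃ Q a (∑V (λ x → χ x * (Φ x * Φ x))) ⟩
          Q * (a * (Q * ∑V (λ x → χ x * (Φ x * Φ x))))
            ≤⟨ ·-monoˡ (0≤+ q) (·-monoˡ a≥0 Q∑χΦ²-bound) ⟩
          Q * (a * (U * (Q * S₂) + Nd * (W * a * (W * a))))
            ≡⟨ cong (λ t → Q * (a * (U * t + Nd * (W * a * (W * a))))) QS₂ ⟩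
          Q * (a * (U * (W * R) + Nd * (W * a * (W * a))))
            ≤⟨ ·-monoˡ (0≤+ q) (·-monoˡ a≥0 (+-mono-≤
                 (·-mono (E²≥0 c₀) U-bound (<⇒≤ W>0 ·≥ R≥0) ≤-refl) ≤-refl)) ⟩
          Q * (a * ((r * r * (B c₀ * B c₀) + a * a) * (W * R) + Nd * (W * a * (W * a))))
            ≡⟨ id₄ Q a (r * r * (B c₀ * B c₀) + a * a) W R Nd ⟩
          W * (Q * (a * ((r * r * (B c₀ * B c₀) + a * a) * R + Nd * (W * (a * a))))) ∎)
          where
          open ≤-Reasoning
          id₁ : ∀ w r → w * (w * (r * r)) ≡ w * r * (w * r)
          id₁ = solve-∀
          id₂ : ∀ q s → q * s * (q * s) ≡ q * (q * (s * s))
          id₂ = solve-∀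
          id₃ : ∀ q a s → q * (q * (a * s)) ≡ q * (a * (q * s))
          id₃ = solve-∀
          id₄ : ∀ q a u w r n → q * (a * (u * (w * r) + n * (w * a * (w * a)))) ≡
            w * (q * (a * (u * r + n * (w * (a * a)))))
          id₄ = solve-∀

      zero-h : V d → F
      zero-h _ = 0F

      -- The test applied to the zero function accepts everything, so the third moment bounds
      -- the number of additive triples in the support of χ from below.
      triples-bound : Q * (a * a * a) ≤ Nd * (r * τ + a * a)
      triples-bound = ·-cancel (·-pos r>0 r>0) (begin
        r * r * (Q * (a * a * a))            ≡⟨ id₁ Q a ⟩
        -- For h = 0 the zero form agrees on all of A, so B = a and E = r a. Of the nonnegative
        -- terms of `S₂` only this one is kept.
        Q * ((Q * a - a) * (Q * a - a) * a)  ≡⟨ cong (λ b → Q * ((Q * b - a) * (Q * b - a) * b)) B-zero ⟨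
        Q * (E 0V * E 0V * B 0V)             ≤⟨ ·-monoˡ (0≤+ q) (∑-single (vectorEnumeration d)
                                                  (λ c → E c * E c * B c) (λ c → E²≥0 c ·≥ B≥0 c) 0V) ⟩
        Q * S₂                               ≡⟨ QS₂ ⟩
        W * R                                ≡⟨ cong (λ t → W * (Q * t - τ + a * a)) τ⁰≡τ ⟩
        W * (Q * τ - τ + a * a)              ≡⟨ id₂ Q Nd τ a ⟩
        r * r * (Nd * (r * τ + a * a)) ∎)
        where
        open ≤-Reasoning
        open Agreement zero-h (λ s x → sym (⊗-zeroʳ s))
        id₁ : ∀ q a → (q - 1ℤ) * (q - 1ℤ) * (q * (a * a * a)) ≡ q * ((q * a - a) * (q * a - a) * a)
        id₁ = solve-∀
        id₂ : ∀ q n t a → (q - 1ℤ) * (q - 1ℤ) * n * (q * t - t + a * a) ≡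
          (q - 1ℤ) * (q - 1ℤ) * (n * ((q - 1ℤ) * t + a * a))
        id₂ = solve-∀
        B-zero : B 0V ≡ a
        B-zero = ∑-cong (allVecs q d) (λ x → trans
          (cong (χ x *_) (⟦⟧-yes (K 0V x ≟F 0F)
            (trans (cong₂ _⊕_ (∙-zero x) (⊗-zeroʳ −1F)) (⊕-identityˡ 0F))))
          (*-identityʳ (χ x)))
        τ⁰≡τ : τ⁰ ≡ τ
        τ⁰≡τ = ∑∑-cong (allVecs q d) (allVecs q d) (λ x y → cong (λ t → χ x * (χ y * t)) (trans
          (cong (χ (x ⊞ y) *_) (⟦⟧-yes (D x y ≟F 0F)
            (trans (cong₂ _⊕_ (⊕-identityˡ 0F) (⊗-zeroʳ −1F)) (⊕-identityˡ 0F))))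
          (*-identityʳ (χ (x ⊞ y)))))

  -- Polynomial inequalities behind the two decodings.

  0<+ : ∀ n → 0ℤ < +[1+ n ]
  0<+ n = +<+ z<s

  gap>0 : ∀ {x y} → x < y → 0ℤ < y - x
  gap>0 {x} {y} x<y = subst (_< y - x) (+-inverseʳ x) (+-monoˡ-< (- x) x<y)

  ≥0-cancel : ∀ {z t} → 0ℤ < z → 0ℤ ≤ z * t → 0ℤ ≤ t
  ≥0-cancel {z} {t} z>0 p = ·-cancel z>0 (subst (_≤ z * t) (sym (*-zeroʳ z)) p)

  square-cancel : ∀ {x y} → 0ℤ ≤ y → x * x ≤ y * y → x ≤ y
  square-cancel {x} {y} y≥0 le with x ≤? y
  ... | yes x≤y = x≤y
  ... | no x≰y = ⊥-elim (<⇒≱ (·-pos (gap>0 y<x) (+-mono-<-≤ (≤-<-trans y≥0 y<x) y≥0))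
                   (≤-trans (≤-reflexive (id x y)) (i≤j⇒i-j≤0 le)))
    where
    y<x : y < x
    y<x = ≰⇒> x≰y
    id : ∀ x y → (x - y) * (x + y) ≡ x * x - y * y
    id = solve-∀

  module _ {q : ℤ} (q≥2 : 1ℤ ≤ q - 1ℤ) {n : ℤ} (n>0 : 0ℤ < n) where

    private
      r : ℤ
      r = q - 1ℤ

      n≥0 : 0ℤ ≤ n
      n≥0 = <⇒≤ n>0

      r>0 : 0ℤ < r
      r>0 = <-≤-trans (0<+ 0) q≥2

      r≥0 : 0ℤ ≤ r
      r≥0 = <⇒≤ r>0

      q>0 : 0ℤ < q
      q>0 = subst (0ℤ <_) (id q) (+-mono-<-≤ r>0 (0≤+ 1))
        where
        id : ∀ q → q - 1ℤ + 1ℤ ≡ q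
        id = solve-∀

      q≥0 : 0ℤ ≤ q
      q≥0 = <⇒≤ q>0

    -- The decoding inequality with a = n and R = q s reads s ≤ B² + n²/r² + n⁴/(q s). The size of s
    -- gives r² s ≥ 4 n² and q s² ≥ 200 n⁴, so the last two terms are together below s/2.
    first-agreement : ∀ {s B} → 0ℤ ≤ s → s ≤ n * n →
      + 200 * (n * n * n * n * n * n) ≤ q * (s * s * s) →
      r * r * n * (q * s * (q * s)) ≤
        q * (n * ((r * r * (B * B) + n * n) * (q * s) + n * (r * r * n * (n * n)))) →
      s ≤ + 2 * (B * B)
    first-agreement {s} {B} s≥0 s≤n² large decoded = ungap
      -- The argument of `0<+` is one less than the number: the factor here is 4.
      (≥0-cancel (·-pos (·-pos (0<+ 3) (·-pos r>0 r>0)) qs>0)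
        (subst (0ℤ ≤_) (sym (id₅ q n s B))
          (0≤+ 8 ·≥ h +≥ (q≥0 ·≥ s≥0) ·≥ r²s≥4n² +≥ 0≤+ 2 ·≥ r≥0 ·≥ r≥0 ·≥
            (qs²≥200n⁴ +≥ 0≤+ 196 ·≥ n≥0 ·≥ n≥0 ·≥ n≥0 ·≥ n≥0))))
      where
      n²>0 : 0ℤ < n * n
      n²>0 = ·-pos n>0 n>0
      id₁ : ∀ q n s → n * n * (n * n) * (q * s - + 200 * (n * n)) ≡
        q * (s * ((n * n - s) * (n * n + s))) + (q * (s * s * s) - + 200 * (n * n * n * n * n * n))
      id₁ = solve-∀
      qs≥200n² : 0ℤ ≤ q * s - + 200 * (n * n)
      qs≥200n² = ≥0-cancel (·-pos n²>0 n²>0) (subst (0ℤ ≤_) (sym (id₁ q n s))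
        (q≥0 ·≥ s≥0 ·≥ gap s≤n² ·≥ (n≥0 ·≥ n≥0 +≥ s≥0) +≥ gap large))
      id₂ : ∀ q n s → n * n * (q * (s * s) - + 200 * (n * (n * (n * n)))) ≡
        q * (s * (s * (n * n - s))) + (q * (s * s * s) - + 200 * (n * n * n * n * n * n))
      id₂ = solve-∀
      qs²≥200n⁴ : 0ℤ ≤ q * (s * s) - + 200 * (n * (n * (n * n)))
      qs²≥200n⁴ = ≥0-cancel n²>0 (subst (0ℤ ≤_) (sym (id₂ q n s))
        (q≥0 ·≥ s≥0 ·≥ s≥0 ·≥ gap s≤n² +≥ gap large))
      qs>0 : 0ℤ < q * s
      qs>0 = <-≤-trans (·-pos (0<+ 199) n²>0) (ungap qs≥200n²)
      id₃ : ∀ q n s → + 2 * ((q - 1ℤ) * ((q - 1ℤ) * s) - + 4 * (n * n)) ≡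
        + 2 * ((q - 1ℤ) * ((q - 1ℤ - 1ℤ) * s)) + (q - 1ℤ - 1ℤ) * s
          + (q * s - + 200 * (n * n)) + + 192 * (n * n)
      id₃ = solve-∀
      -- The factor 2 stems from comparing r² s with q s through q ≤ 2 r², which holds for q ≥ 2.
      r²s≥4n² : 0ℤ ≤ + 2 * (r * (r * s) - + 4 * (n * n))
      r²s≥4n² = subst (0ℤ ≤_) (sym (id₃ q n s))
        (0≤+ 2 ·≥ r≥0 ·≥ gap q≥2 ·≥ s≥0 +≥ gap q≥2 ·≥ s≥0 +≥ qs≥200n² +≥ 0≤+ 192 ·≥ n≥0 ·≥ n≥0)
      id₄ : ∀ q n s B →
        q * (n * (((q - 1ℤ) * (q - 1ℤ) * (B * B) + n * n) * (q * s) + n * ((q - 1ℤ) * (q - 1ℤ) * n * (n * n))))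
          - (q - 1ℤ) * (q - 1ℤ) * n * (q * s * (q * s)) ≡
        q * n * (((q - 1ℤ) * (q - 1ℤ) * (B * B) + n * n) * (q * s)
          + (q - 1ℤ) * (q - 1ℤ) * (n * n * n * n) - (q - 1ℤ) * (q - 1ℤ) * (q * (s * s)))
      id₄ = solve-∀
      h : 0ℤ ≤ (r * r * (B * B) + n * n) * (q * s) + r * r * (n * n * n * n) - r * r * (q * (s * s))
      h = ≥0-cancel (·-pos q>0 n>0) (subst (0ℤ ≤_) (id₄ q n s B) (gap decoded))
      id₅ : ∀ q n s B → + 4 * ((q - 1ℤ) * (q - 1ℤ)) * (q * s) * (+ 2 * (B * B) - s) ≡
        + 8 * (((q - 1ℤ) * (q - 1ℤ) * (B * B) + n * n) * (q * s)
          + (q - 1ℤ) * (q - 1ℤ) * (n * n * n * n) - (q - 1ℤ) * (q - 1ℤ) * (q * (s * s)))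
        + q * s * (+ 2 * ((q - 1ℤ) * ((q - 1ℤ) * s) - + 4 * (n * n)))
        + + 2 * ((q - 1ℤ) * ((q - 1ℤ) * (q * (s * s) - + 200 * (n * (n * (n * n)))
            + + 196 * (n * (n * (n * n))))))
      id₅ = solve-∀

    -- Put X = n R; then q a³ ≤ X + n³ ≤ 2 X. Dividing the decoding inequality by X gives q a (a² -
    -- B²) ≤ 5 n³, where 5 = 1 + 2 + 2: the loss in X, the off-diagonal term, and q a³ ≤ 2 r² n³.
    -- Finally a² - B² ≥ a (a - B).
    second-agreement : ∀ {a B R} → 0ℤ ≤ a → a ≤ n → 0ℤ ≤ B → B ≤ a →
      + 2 * (n * n * n) ≤ q * (a * a * a) →
      q * (a * a * a) - n * n * n ≤ n * R →
      r * r * n * (R * R) ≤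
        q * (a * ((r * r * (B * B) + a * a) * R + n * (r * r * n * (a * a)))) →
      q * (a * a * (a - B)) ≤ + 5 * (n * n * n)
    second-agreement {a} {B} {R} a≥0 a≤n B≥0 B≤a dense R-large decoded =
      gap-by (k₂ +≥ q≥0 ·≥ a≥0 ·≥ B≥0 ·≥ gap B≤a) (id₆ q n a B)
      where
      n³≥0 : 0ℤ ≤ n * n * n
      n³≥0 = (n≥0 ·≥ n≥0) ·≥ n≥0
      id₀ : ∀ q n a X → X - n * n * n ≡
        X - (q * (a * a * a) - n * n * n) + (q * (a * a * a) - + 2 * (n * n * n))
      id₀ = solve-∀
      X≥n³ : 0ℤ ≤ n * R - n * n * n
      X≥n³ = subst (0ℤ ≤_) (sym (id₀ q n a (n * R))) (gap R-large +≥ gap dense)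
      X>0 : 0ℤ < n * R
      X>0 = <-≤-trans (·-pos (·-pos n>0 n>0) n>0) (ungap X≥n³)
      id₁ : ∀ q n a X → + 2 * X - q * (a * a * a) ≡
        X - (q * (a * a * a) - n * n * n) + (X - n * n * n)
      id₁ = solve-∀
      qa³≤2X : 0ℤ ≤ + 2 * (n * R) - q * (a * a * a)
      qa³≤2X = subst (0ℤ ≤_) (sym (id₁ q n a (n * R))) (gap R-large +≥ X≥n³)
      id₂ : ∀ q n a B R →
        n * R * (q * (a * ((q - 1ℤ) * (q - 1ℤ) * (B * B) + a * a)) + + 2 * ((q - 1ℤ) * (q - 1ℤ) * (n * n * n))
          - (q - 1ℤ) * (q - 1ℤ) * (n * R)) ≡
        n * (q * (a * (((q - 1ℤ) * (q - 1ℤ) * (B * B) + a * a) * R + n * ((q - 1ℤ) * (q - 1ℤ) * n * (a * a))))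
          - (q - 1ℤ) * (q - 1ℤ) * n * (R * R))
        + (q - 1ℤ) * ((q - 1ℤ) * (n * n * n * (+ 2 * (n * R) - q * (a * a * a))))
      id₂ = solve-∀
      k₁ : 0ℤ ≤ q * (a * (r * r * (B * B) + a * a)) + + 2 * (r * r * (n * n * n)) - r * r * (n * R)
      k₁ = ≥0-cancel X>0 (subst (0ℤ ≤_) (sym (id₂ q n a B R))
        (n≥0 ·≥ gap decoded +≥ r≥0 ·≥ r≥0 ·≥ n³≥0 ·≥ qa³≤2X))
      id₃ : ∀ q n a → + 2 * ((q - 1ℤ) * (q - 1ℤ) * (n * n * n)) - q * (a * a * a) ≡
        q * ((n - a) * (n * n + n * a + a * a)) + (q - 1ℤ - 1ℤ) * (n * n * n)
          + + 2 * ((q - 1ℤ) * ((q - 1ℤ - 1ℤ) * (n * n * n)))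
      id₃ = solve-∀
      qa³≤2r²n³ : 0ℤ ≤ + 2 * (r * r * (n * n * n)) - q * (a * a * a)
      qa³≤2r²n³ = subst (0ℤ ≤_) (sym (id₃ q n a))
        (q≥0 ·≥ gap a≤n ·≥ (n≥0 ·≥ n≥0 +≥ n≥0 ·≥ a≥0 +≥ a≥0 ·≥ a≥0) +≥ gap q≥2 ·≥ n³≥0
          +≥ 0≤+ 2 ·≥ r≥0 ·≥ gap q≥2 ·≥ n³≥0)
      id₄ : ∀ q n a B X →
        (q - 1ℤ) * (q - 1ℤ) * (+ 5 * (n * n * n) + q * (a * (B * B)) - q * (a * a * a)) ≡
        (q * (a * ((q - 1ℤ) * (q - 1ℤ) * (B * B) + a * a)) + + 2 * ((q - 1ℤ) * (q - 1ℤ) * (n * n * n))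
          - (q - 1ℤ) * (q - 1ℤ) * X)
        + (q - 1ℤ) * ((q - 1ℤ) * (X - (q * (a * a * a) - n * n * n)))
        + (+ 2 * ((q - 1ℤ) * (q - 1ℤ) * (n * n * n)) - q * (a * a * a))
      id₄ = solve-∀
      k₂ : 0ℤ ≤ + 5 * (n * n * n) + q * (a * (B * B)) - q * (a * a * a)
      k₂ = ≥0-cancel (·-pos r>0 r>0) (subst (0ℤ ≤_) (sym (id₄ q n a B (n * R)))
        (k₁ +≥ r≥0 ·≥ r≥0 ·≥ gap R-large +≥ qa³≤2r²n³))
      id₆ : ∀ q n a B → + 5 * (n * n * n) - q * (a * a * (a - B)) ≡
        + 5 * (n * n * n) + q * (a * (B * B)) - q * (a * a * a) + q * (a * (B * (a - B)))
      id₆ = solve-∀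

    module Density {a s} (a≥0 : 0ℤ ≤ a) (s≥0 : 0ℤ ≤ s) (s≤n² : s ≤ n * n) (s≤2a² : s ≤ + 2 * (a * a))
      (large : + 200 * (n * n * n * n * n * n) ≤ q * (s * s * s)) where

      -- A linear substitute for a/n ≥ √(ε/2) that avoids square roots: 4 s² ≤ 4 s n² ≤ 8 a² n² ≤ 9
      -- a² n².
      2s≤3an : + 2 * s ≤ + 3 * (a * n)
      2s≤3an = square-cancel (0≤+ 3 ·≥ a≥0 ·≥ n≥0) (gap-by
        (0≤+ 4 ·≥ n≥0 ·≥ n≥0 ·≥ gap s≤2a² +≥ a≥0 ·≥ a≥0 ·≥ n≥0 ·≥ n≥0 +≥ 0≤+ 4 ·≥ s≥0 ·≥ gap s≤n²)
        (id n a s))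
        where
        id : ∀ n a s → + 3 * (a * n) * (+ 3 * (a * n)) - + 2 * s * (+ 2 * s) ≡
          + 4 * (n * (n * (+ 2 * (a * a) - s))) + a * (a * (n * n)) + + 4 * (s * (n * n - s))
        id = solve-∀

      -- In densities α = a/n and ε = s/n²: α² ≥ ε/2 and α ≥ 2ε/3 give q ε α³ ≥ q ε³ / 3 ≥ 200/3.
      -- The 10 is what the Markov step needs in order to lose at most half of A₁.
      10n⁵≤sqa³ : + 10 * (n * n * n * n * n) ≤ s * (q * (a * a * a))
      10n⁵≤sqa³ = ungap (≥0-cancel (·-pos (0<+ 5) n>0)
        (subst (0ℤ ≤_) (sym (id q n a s))
          (0≤+ 3 ·≥ a≥0 ·≥ n≥0 ·≥ q≥0 ·≥ s≥0 ·≥ gap s≤2a² +≥ q≥0 ·≥ s≥0 ·≥ s≥0 ·≥ gap 2s≤3an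
            +≥ 0≤+ 2 ·≥ gap large +≥ 0≤+ 340 ·≥ n≥0 ·≥ n≥0 ·≥ n≥0 ·≥ n≥0 ·≥ n≥0 ·≥ n≥0)))
        where
        id : ∀ q n a s → + 6 * n * (s * (q * (a * a * a)) - + 10 * (n * n * n * n * n)) ≡
          + 3 * (a * (n * (q * (s * (+ 2 * (a * a) - s))))) + q * (s * (s * (+ 3 * (a * n) - + 2 * s)))
            + + 2 * (q * (s * s * s) - + 200 * (n * n * n * n * n * n))
            + + 340 * (n * (n * (n * (n * (n * n)))))
        id = solve-∀

      2n³≤qa³ : + 2 * (n * n * n) ≤ q * (a * a * a)
      2n³≤qa³ = ungap (≥0-cancel (·-pos n>0 n>0) (subst (0ℤ ≤_) (sym (id q n a s))
        (q≥0 ·≥ a≥0 ·≥ a≥0 ·≥ a≥0 ·≥ gap s≤n² +≥ gap 10n⁵≤sqa³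
          +≥ 0≤+ 8 ·≥ n≥0 ·≥ n≥0 ·≥ n≥0 ·≥ n≥0 ·≥ n≥0)))
        where
        id : ∀ q n a s → n * n * (q * (a * a * a) - + 2 * (n * n * n)) ≡
          q * (a * (a * (a * (n * n - s)))) + (s * (q * (a * a * a)) - + 10 * (n * n * n * n * n))
            + + 8 * (n * (n * (n * (n * n))))
        id = solve-∀

      -- H is the total distance over A₁, b the number of its points that are not close, L = ℓ. The
      -- hypotheses give b ≤ 5 n⁵ / (q a² s) ≤ a/2, hence g ≥ a/2 ≥ s/(3n) ≥ s²/(3n³).
      good-bound : ∀ {b g H L} → 0ℤ ≤ b → 0ℤ ≤ L →
        q * (a * a * H) ≤ + 5 * (n * n * n) * L → b * (s * L + 1ℤ) ≤ n * n * H → a ≤ g + b →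
        s * s ≤ + 3 * (n * n * n) * g
      good-bound {b} {g} {H} {L} b≥0 L≥0 H-small markov a≤g+b =
        ·-cancel (0<+ 1) (gap-by
          (0≤+ 6 ·≥ n≥0 ·≥ n≥0 ·≥ n≥0 ·≥ gap a≤g+b +≥ 0≤+ 3 ·≥ n≥0 ·≥ n≥0 ·≥ n≥0 ·≥ 2b≤a
            +≥ n≥0 ·≥ n≥0 ·≥ gap 2s≤3an +≥ 0≤+ 2 ·≥ s≥0 ·≥ gap s≤n²)
          (id₃ n a s b g))
        where
        id₁ : ∀ q n a s b H L → + 5 * (n * n * n * n * n) * (s * L + 1ℤ) * (a - + 2 * b) ≡
          + 5 * (n * (n * (n * (n * (n * a)))))
          + s * (a * (n * (n * (+ 5 * (n * n * n) * L - q * (a * a * H)))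
              + q * (a * (a * (n * n * H - b * (s * L + 1ℤ))))))
          + b * ((s * L + 1ℤ) * (s * (q * (a * a * a)) - + 10 * (n * n * n * n * n)))
        id₁ = solve-∀
        -- The 1 keeps the divisor positive when s L = 0.
        sL+1>0 : 0ℤ < s * L + 1ℤ
        sL+1>0 = +-mono-≤-< (s≥0 ·≥ L≥0) (0<+ 0)
        2b≤a : 0ℤ ≤ a - + 2 * b
        2b≤a = ≥0-cancel
          (·-pos (·-pos (0<+ 4) (·-pos (·-pos (·-pos (·-pos n>0 n>0) n>0) n>0) n>0)) sL+1>0)
          (subst (0ℤ ≤_) (sym (id₁ q n a s b H L))
            (0≤+ 5 ·≥ n≥0 ·≥ n≥0 ·≥ n≥0 ·≥ n≥0 ·≥ n≥0 ·≥ a≥0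
              +≥ s≥0 ·≥ a≥0 ·≥ (n≥0 ·≥ n≥0 ·≥ gap H-small +≥ q≥0 ·≥ a≥0 ·≥ a≥0 ·≥ gap markov)
              +≥ b≥0 ·≥ <⇒≤ sL+1>0 ·≥ gap 10n⁵≤sqa³))
        id₃ : ∀ n a s b g → + 2 * (+ 3 * (n * n * n) * g) - + 2 * (s * s) ≡
          + 6 * (n * (n * (n * (g + b - a)))) + + 3 * (n * (n * (n * (a - + 2 * b))))
            + n * (n * (+ 3 * (a * n) - + 2 * s)) + + 2 * (s * (n * n - s))
        id₃ = solve-∀

  -- List lengths as sums, and inequalities between indicators.

  ∑-allFin-suc : ∀ n (G : Fin (suc n) → ℤ) → ∑ (allFin (suc n)) G ≡ G zero + ∑ (allFin n) (G ∘ suc)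
  ∑-allFin-suc n G = cong (_+_ (G zero))
    (trans (cong (λ xs → ∑ xs G) (sym (List.map-tabulate (λ i → i) suc))) (∑-map suc (allFin n) G))

  ∑-filter : {A : Set} {P : Pred A 0ℓ} (P? : Decidable P) (xs : List A) (G : A → ℤ) →
    ∑ (filter P? xs) G ≡ ∑ xs (λ x → ⟦ P? x ⟧ * G x)
  ∑-filter P? List.[] G = refl
  ∑-filter P? (x List.∷ xs) G with P? x
  ... | yes _ = cong₂ _+_ (sym (*-identityˡ (G x))) (∑-filter P? xs G)
  ... | no _ = trans (∑-filter P? xs G) (sym (+-identityˡ (∑ xs (λ x → ⟦ P? x ⟧ * G x))))

  length-as-∑ : {A : Set} (xs : List A) → + length xs ≡ ∑ xs (λ _ → 1ℤ)
  length-as-∑ xs = sym (trans (∑-const xs 1ℤ) (*-identityʳ (+ length xs)))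

  ⟦⟧-mono : {P P′ : Set} (d : Dec P) (d′ : Dec P′) → (P → P′) → ⟦ d ⟧ ≤ ⟦ d′ ⟧
  ⟦⟧-mono (yes p) d′ imp = ≤-reflexive (sym (⟦⟧-yes d′ (imp p)))
  ⟦⟧-mono (no _) d′ imp = ⟦⟧≥0 d′

  ⟦⟧-unless : {P : Set} (p : Dec P) {m t : ℤ} → 0ℤ ≤ t → (¬ P → m ≤ t) → (1ℤ - ⟦ p ⟧) * m ≤ t
  ⟦⟧-unless (yes _) t≥0 bound = t≥0
  ⟦⟧-unless (no ¬p) {m} t≥0 bound = subst (_≤ _) (sym (*-identityˡ m)) (bound ¬p)

  -- Meant for p, p′, p″ the memberships of x, y, x + y in A₁, d acceptance by one coordinate, z
  -- vanishing of γ on the defect and z′ vanishing of the defect: a triple lost to rejection is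
  -- spurious.
  ⟦⟧-rejected : {P P′ P″ D Z Z′ : Set} (p : Dec P) (p′ : Dec P′) (p″ : Dec P″)
    (d : Dec D) (z : Dec Z) (z′ : Dec Z′) → (P → P′ → P″ → Z) → (Z′ → D) →
    ⟦ p ⟧ * (⟦ p′ ⟧ * ⟦ p″ ⟧) - ⟦ p ⟧ * (⟦ p′ ⟧ * (⟦ p″ ⟧ * ⟦ d ⟧)) ≤ ⟦ z ⟧ * (1ℤ - ⟦ z′ ⟧)
  ⟦⟧-rejected (no _) _ _ d z z′ _ _ = ⟦⟧≥0 z ·≥ gap (⟦⟧≤1 z′)
  ⟦⟧-rejected (yes _) (no _) _ d z z′ _ _ = ⟦⟧≥0 z ·≥ gap (⟦⟧≤1 z′)
  ⟦⟧-rejected (yes _) (yes _) (no _) d z z′ _ _ = ⟦⟧≥0 z ·≥ gap (⟦⟧≤1 z′)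
  ⟦⟧-rejected (yes a) (yes b) (yes c) d z z′ imp imp′ = subst₂ _≤_
    (id ⟦ d ⟧)
    (trans (sym (*-identityˡ (1ℤ - ⟦ z′ ⟧))) (cong (_* (1ℤ - ⟦ z′ ⟧)) (sym (⟦⟧-yes z (imp a b c)))))
    (+-monoʳ-≤ 1ℤ (neg-mono-≤ (⟦⟧-mono z′ d imp′)))
    where
    id : ∀ t → 1ℤ - t ≡ 1ℤ * (1ℤ * 1ℤ) - 1ℤ * (1ℤ * (1ℤ * t))
    id = solve-∀

  -- The choice of γ, the set A₁ and the decoding of each coordinate.

  module LinearityTest (q : ℕ) .{{_ : NonZero q}} (pr : Prime q) where

    open Residues q
    open Field pr
    open Vectors q pr
    open Moments q pr

    r≥1 : 1ℤ ≤ Q - 1ℤ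
    r≥1 = i<j⇒suc[i]≤j r>0

    ⊗-zero-cancel : ∀ s t → s ≢ 0F → s ⊗ t ≡ 0F → t ≡ 0F
    ⊗-zero-cancel s t s≢0 eq with inverse s s≢0
    ... | s⁻¹ , s⁻¹s = begin
      t                 ≡⟨ ⊗-identityˡ t ⟨
      1F ⊗ t            ≡⟨ cong (_⊗ t) s⁻¹s ⟨
      s⁻¹ ⊗ s ⊗ t       ≡⟨ ⊗-assoc s⁻¹ s t ⟩
      s⁻¹ ⊗ (s ⊗ t)     ≡⟨ cong (s⁻¹ ⊗_) eq ⟩
      s⁻¹ ⊗ 0F          ≡⟨ ⊗-zeroʳ s⁻¹ ⟩
      0F ∎
      where open ≡-Reasoning

    hammingCount-∑ : ∀ {n} (u v : V n) →
      + hammingCount q u v ≡ ∑ (allFin n) (λ i → 1ℤ - ⟦ lookup v i ≟F lookup u i ⟧)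
    hammingCount-∑ [] [] = refl
    hammingCount-∑ {suc n} (x ∷ u) (y ∷ v) with x ≟F y
    ... | yes refl = begin
      + hammingCount q u v
        ≡⟨ hammingCount-∑ u v ⟩
      ∑ (allFin n) (λ i → 1ℤ - ⟦ lookup v i ≟F lookup u i ⟧)
        ≡⟨ +-identityˡ _ ⟨
      0ℤ + ∑ (allFin n) (λ i → 1ℤ - ⟦ lookup v i ≟F lookup u i ⟧)
        ≡⟨ cong (λ t → 1ℤ - t + ∑ (allFin n) (λ i → 1ℤ - ⟦ lookup v i ≟F lookup u i ⟧)) (⟦⟧-yes (x ≟F x) refl) ⟨
      (1ℤ - ⟦ x ≟F x ⟧) + ∑ (allFin n) (λ i → 1ℤ - ⟦ lookup v i ≟F lookup u i ⟧)
        ≡⟨ ∑-allFin-suc n (λ i → 1ℤ - ⟦ lookup (x ∷ v) i ≟F lookup (x ∷ u) i ⟧) ⟨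
      ∑ (allFin (suc n)) (λ i → 1ℤ - ⟦ lookup (x ∷ v) i ≟F lookup (x ∷ u) i ⟧) ∎
      where open ≡-Reasoning
    ... | no x≢y = begin
      1ℤ + + hammingCount q u v
        ≡⟨ cong (_+_ 1ℤ) (hammingCount-∑ u v) ⟩
      1ℤ + ∑ (allFin n) (λ i → 1ℤ - ⟦ lookup v i ≟F lookup u i ⟧)
        ≡⟨ cong (λ t → 1ℤ - t + ∑ (allFin n) (λ i → 1ℤ - ⟦ lookup v i ≟F lookup u i ⟧))
             (⟦⟧-no (y ≟F x) (λ eq → x≢y (sym eq))) ⟨
      (1ℤ - ⟦ y ≟F x ⟧) + ∑ (allFin n) (λ i → 1ℤ - ⟦ lookup v i ≟F lookup u i ⟧)
        ≡⟨ ∑-allFin-suc n (λ i → 1ℤ - ⟦ lookup (y ∷ v) i ≟F lookup (x ∷ u) i ⟧) ⟨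
      ∑ (allFin (suc n)) (λ i → 1ℤ - ⟦ lookup (y ∷ v) i ≟F lookup (x ∷ u) i ⟧) ∎
      where open ≡-Reasoning

    module Decoding (d ℓ : ℕ) (f : V d → V ℓ) (f-hom : ScalarRespecting q f) where

      n : ℤ
      n = N d

      n>0 : 0ℤ < n
      n>0 = N>0 d

      n≥0 : 0ℤ ≤ n
      n≥0 = <⇒≤ n>0

      ∑V : (V d → ℤ) → ℤ
      ∑V = ∑ (allVecs q d)

      s : ℤ
      s = ∑V (λ x → ∑V (λ y → ⟦ accepts? q f x y ⟧))

      defect : V d → V d → V ℓ
      defect x y = f x ⊞ f y ⊞ −1F ⊡ f (x ⊞ y)

      accepted-defect : ∀ x y → Accepts q f x y → defect x y ≡ 0V
      accepted-defect x y acc = trans (cong (_⊞ −1F ⊡ f (x ⊞ y)) acc) (⊞-inverse (f (x ⊞ y)))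

      ∑∑-mono : {G H : V d → V d → ℤ} → (∀ x y → G x y ≤ H x y) →
        ∑V (λ x → ∑V (G x)) ≤ ∑V (λ x → ∑V (H x))
      ∑∑-mono le = ∑-mono (allVecs q d) (λ x → ∑-mono (allVecs q d) (le x))

      ∑∑-const : ∀ c → ∑V (λ _ → ∑V (λ _ → c)) ≡ n * (n * c)
      ∑∑-const c = trans (∑V-const d _) (cong (n *_) (∑V-const d c))

      s≥0 : 0ℤ ≤ s
      s≥0 = ∑≥0 (allVecs q d) (λ x → ∑≥0 (allVecs q d) (λ y → ⟦⟧≥0 (accepts? q f x y)))

      -- Pairs accepted by γ · f but rejected by f, expressed through the defect so that the sum
      -- over γ is a hyperplane count.
      spurious : V ℓ → V d → V d → ℤ
      spurious γ x y = ⟦ (γ ∙ defect x y) ≟F 0F ⟧ * (1ℤ - ⟦ defect x y ≟V 0V ⟧)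

      ∑-spurious : ∀ x y → Q * ∑ (allVecs q ℓ) (λ γ → spurious γ x y) ≤ N ℓ
      ∑-spurious x y with defect x y ≟V 0V
      ... | yes _ = ≤-trans (≤-reflexive (trans
        (cong (Q *_) (trans (∑-cong (allVecs q ℓ) (λ γ → *-zeroʳ ⟦ (γ ∙ defect x y) ≟F 0F ⟧)) (∑-zero (allVecs q ℓ))))
        (*-zeroʳ Q))) (0≤+ (q ℕ.^ ℓ))
      ... | no v≢0 = ≤-reflexive (trans
        (cong (Q *_) (∑-cong (allVecs q ℓ) (λ γ → *-identityʳ ⟦ (γ ∙ defect x y) ≟F 0F ⟧)))
        (hyperplane (defect x y) v≢0))

      least : ∃ λ γ → ∀ γ′ → - ∑V (λ x → ∑V (spurious γ′ x)) ≤ - ∑V (λ x → ∑V (spurious γ x))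
      least = maximizer (vectorEnumeration ℓ) 0V (λ γ → - ∑V (λ x → ∑V (spurious γ x)))

      γ : V ℓ
      γ = proj₁ least

      -- The minimising γ does at least as well as the average over all γ, which `∑-spurious` bounds
      -- by n²/q.
      few-spurious : Q * ∑V (λ x → ∑V (spurious γ x)) ≤ n * n
      few-spurious = ·-cancel (N>0 ℓ) (begin
        N ℓ * (Q * ∑V (λ x → ∑V (spurious γ x)))
          ≡⟨ swap (N ℓ) Q (∑V (λ x → ∑V (spurious γ x))) ⟩
        Q * (N ℓ * ∑V (λ x → ∑V (spurious γ x)))
          ≡⟨ cong (Q *_) (∑V-const ℓ (∑V (λ x → ∑V (spurious γ x)))) ⟨
        Q * ∑ (allVecs q ℓ) (λ _ → ∑V (λ x → ∑V (spurious γ x)))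
          ≤⟨ ·-monoˡ (0≤+ q) (∑-mono (allVecs q ℓ) (λ γ′ → neg-cancel-≤ (proj₂ least γ′))) ⟩
        Q * ∑ (allVecs q ℓ) (λ γ′ → ∑V (λ x → ∑V (spurious γ′ x)))
          ≡⟨ cong (Q *_) (∑-swap₃ (allVecs q ℓ) (allVecs q d) (allVecs q d) spurious) ⟩
        Q * ∑V (λ x → ∑V (λ y → ∑ (allVecs q ℓ) (λ γ′ → spurious γ′ x y)))
          ≡⟨ ∑∑-*ˡ (allVecs q d) (allVecs q d) Q (λ x y → ∑ (allVecs q ℓ) (λ γ′ → spurious γ′ x y)) ⟨
        ∑V (λ x → ∑V (λ y → Q * ∑ (allVecs q ℓ) (λ γ′ → spurious γ′ x y)))
          ≤⟨ ∑∑-mono ∑-spurious ⟩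
        ∑V (λ _ → ∑V (λ _ → N ℓ))
          ≡⟨ ∑∑-const (N ℓ) ⟩
        n * (n * N ℓ)
          ≡⟨ rotate n (N ℓ) ⟩
        N ℓ * (n * n) ∎)
        where
        open ≤-Reasoning
        swap : ∀ m q t → m * (q * t) ≡ q * (m * t)
        swap = solve-∀
        rotate : ∀ n m → n * (n * m) ≡ m * (n * n)
        rotate = solve-∀

      h : V d → F
      h x = γ ∙ f x

      h-hom : ∀ t x → h (t ⊡ x) ≡ t ⊗ h x
      h-hom t x = trans (cong (γ ∙_) (f-hom t x)) (∙-⊡ γ t (f x))

      γ-defect : ∀ x y → γ ∙ defect x y ≡ h x ⊕ h y ⊕ −1F ⊗ h (x ⊞ y)
      γ-defect x y = trans (∙-⊞ γ (f x ⊞ f y) (−1F ⊡ f (x ⊞ y)))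
        (cong₂ _⊕_ (∙-⊞ γ (f x) (f y)) (∙-⊡ γ −1F (f (x ⊞ y))))

      module Whole = Weighted d (λ _ → 1ℤ) (λ _ → refl) (λ _ _ _ → refl)
      module First = Whole.Agreement h h-hom

      c₁ : V d
      c₁ = First.c₀

      K₁ : V d → F
      K₁ = First.K c₁

      χ : V d → ℤ
      χ x = ⟦ K₁ x ≟F 0F ⟧

      χ-scale : ∀ t x → t ≢ 0F → χ (t ⊡ x) ≡ χ x
      χ-scale t x t≢0 = ⟦⟧-cong (K₁ (t ⊡ x) ≟F 0F) (K₁ x ≟F 0F)
        (λ eq → ⊗-zero-cancel t (K₁ x) t≢0 (trans (sym (First.K-hom c₁ t x)) eq))
        (λ eq → trans (First.K-hom c₁ t x) (trans (cong (t ⊗_) eq) (⊗-zeroʳ t)))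

      module Part = Weighted d χ (λ x → ⟦⟧-idem (K₁ x ≟F 0F)) χ-scale

      open Part using (a; a≥0)

      whole-a : Whole.a ≡ n
      whole-a = trans (∑V-const d 1ℤ) (*-identityʳ n)

      first-B : First.B c₁ ≡ a
      first-B = ∑-cong (allVecs q d) (λ x → *-identityˡ (χ x))

      a≤n : a ≤ n
      a≤n = subst₂ _≤_ first-B whole-a (First.B≤a c₁)

      first-τ⁰ : First.τ⁰ ≡ ∑V (λ x → ∑V (λ y → ⟦ First.D x y ≟F 0F ⟧))
      first-τ⁰ = ∑∑-cong (allVecs q d) (allVecs q d) (λ x y → id ⟦ First.D x y ≟F 0F ⟧)
        where
        id : ∀ t → 1ℤ * (1ℤ * (1ℤ * t)) ≡ t
        id = solve-∀

      s≤τ⁰ : s ≤ First.τ⁰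
      s≤τ⁰ = subst (s ≤_) (sym first-τ⁰) (∑∑-mono (λ x y →
        ⟦⟧-mono (accepts? q f x y) (First.D x y ≟F 0F) (λ acc →
          trans (sym (γ-defect x y)) (trans (cong (γ ∙_) (accepted-defect x y acc))
            (trans (∙-comm γ 0V) (∙-zero γ))))))

      τ⁰≤n² : First.τ⁰ ≤ n * n
      τ⁰≤n² = subst₂ _≤_ (sym first-τ⁰) (trans (∑∑-const 1ℤ) (cong (n *_) (*-identityʳ n)))
        (∑∑-mono (λ x y → ⟦⟧≤1 (First.D x y ≟F 0F)))

      s≤n² : s ≤ n * n
      s≤n² = ≤-trans s≤τ⁰ τ⁰≤n²

      -- On the whole space τ and a² are both n² and cancel.
      first-R : First.R ≡ Q * First.τ⁰
      first-R = trans (cong₂ (λ t u → Q * First.τ⁰ - t + u * u)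
          (trans (∑∑-const 1ℤ) (cong (n *_) (*-identityʳ n))) whole-a)
        (id (Q * First.τ⁰) (n * n))
        where
        id : ∀ x y → x - y + y ≡ x
        id = solve-∀

      module Dense (large : + 200 * (n * n * n * n * n * n) ≤ Q * (s * s * s)) where

        -- The first decoding is applied to the number τ⁰ of pairs accepted by γ · f. Passing from f
        -- to γ · f loses no accepted pair, so s ≤ τ⁰.
        s≤2a² : s ≤ + 2 * (a * a)
        s≤2a² = ≤-trans s≤τ⁰ (subst (λ b → First.τ⁰ ≤ + 2 * (b * b)) first-B
          (first-agreement {Q} r≥1 {n} n>0 {B = First.B c₁} (≤-trans s≥0 s≤τ⁰) τ⁰≤n²
            (≤-trans large (·-monoˡ (0≤+ q) (·-mono (s≥0 ·≥ s≥0) (·-mono s≥0 s≤τ⁰ s≥0 s≤τ⁰) s≥0 s≤τ⁰)))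
            (subst₂ (λ m t → r * r * n * (t * t) ≤
                Q * (m * ((r * r * (First.B c₁ * First.B c₁) + m * m) * t + n * (r * r * n * (m * m)))))
              whole-a first-R First.decode)))

        open Density {Q} r≥1 {n} n>0 a≥0 s≥0 s≤n² s≤2a² large

        module Coordinate (i : Fin ℓ) where

          hᵢ : V d → F
          hᵢ x = lookup (f x) i

          hᵢ-hom : ∀ t x → hᵢ (t ⊡ x) ≡ t ⊗ hᵢ x
          hᵢ-hom t x = trans (cong (λ v → lookup v i) (f-hom t x)) (Vec.lookup-map i (t ⊗_) (f x))

          open Part.Agreement hᵢ hᵢ-hom public

          defect-lookup : ∀ x y → lookup (defect x y) i ≡ D x y
          defect-lookup x y = trans (Vec.lookup-zipWith _⊕_ i (f x ⊞ f y) (−1F ⊡ f (x ⊞ y)))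
            (cong₂ _⊕_ (Vec.lookup-zipWith _⊕_ i (f x) (f y)) (Vec.lookup-map i (−1F ⊗_) (f (x ⊞ y))))

          zero-defect : ∀ x y → K₁ x ≡ 0F → K₁ y ≡ 0F → K₁ (x ⊞ y) ≡ 0F → γ ∙ defect x y ≡ 0F
          zero-defect x y kx ky kxy = begin
            γ ∙ defect x y
              ≡⟨ γ-defect x y ⟩
            h x ⊕ h y ⊕ −1F ⊗ h (x ⊞ y)
              ≡⟨ cong₂ (λ t u → t ⊕ −1F ⊗ u)
                   (cong₂ _⊕_ (⊕-cancel (c₁ ∙ x) (h x) kx) (⊕-cancel (c₁ ∙ y) (h y) ky))
                   (⊕-cancel (c₁ ∙ (x ⊞ y)) (h (x ⊞ y)) kxy) ⟨
            c₁ ∙ x ⊕ c₁ ∙ y ⊕ −1F ⊗ c₁ ∙ (x ⊞ y)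
              ≡⟨ cong (_⊕ −1F ⊗ c₁ ∙ (x ⊞ y)) (∙-⊞ c₁ x y) ⟨
            c₁ ∙ (x ⊞ y) ⊕ −1F ⊗ c₁ ∙ (x ⊞ y)
              ≡⟨ ⊕-inverse (c₁ ∙ (x ⊞ y)) ⟩
            0F ∎
            where open ≡-Reasoning

          -- On A₁ the function γ · f equals the form c₁, so γ annihilates the defect of every
          -- additive triple in A₁; if coordinate i rejects, the defect itself is nonzero.
          rejected-spurious : ∀ x y →
            χ x * (χ y * χ (x ⊞ y)) - χ x * (χ y * (χ (x ⊞ y) * ⟦ D x y ≟F 0F ⟧)) ≤ spurious γ x y
          rejected-spurious x y = ⟦⟧-rejected (K₁ x ≟F 0F) (K₁ y ≟F 0F) (K₁ (x ⊞ y) ≟F 0F)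
            (D x y ≟F 0F) ((γ ∙ defect x y) ≟F 0F) (defect x y ≟V 0V)
            (zero-defect x y)
            (λ eq → trans (sym (defect-lookup x y))
              (trans (cong (λ v → lookup v i) eq) (Vec.lookup-replicate i 0F)))

          τ-gap : Q * (Part.τ - τ⁰) ≤ n * n
          τ-gap = ≤-trans (·-monoˡ (0≤+ q) (≤-trans
            (≤-reflexive (trans (sym (∑-minus (allVecs q d) _ _))
              (∑-cong (allVecs q d) (λ x → sym (∑-minus (allVecs q d) _ _)))))
            (∑∑-mono rejected-spurious))) few-spurious

          -- By `τ-gap` replacing τ⁰ by τ costs at most n³, and n (r τ + a²) is at least Q a³ by the
          -- triple count in A₁.
          R-large : Q * (a * a * a) - n * n * n ≤ n * R
          R-large = gap-by (n≥0 ·≥ gap τ-gap +≥ gap Part.triples-bound) (id Q n a Part.τ τ⁰)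
            where
            id : ∀ q n a t u → n * (q * u - t + a * a) - (q * (a * a * a) - n * n * n) ≡
              n * (n * n - q * (t - u)) + (n * ((q - 1ℤ) * t + a * a) - q * (a * a * a))
            id = solve-∀

          agreement : Q * (a * a * (a - B c₀)) ≤ + 5 * (n * n * n)
          agreement = second-agreement {Q} r≥1 {n} n>0 {B = B c₀} {R = R} a≥0 a≤n (B≥0 c₀) (B≤a c₀) 2n³≤qa³ R-large decode

        c : V d → V ℓ
        c x = tabulate (λ i → Coordinate.c₀ i ∙ x)

        c-linear : Linear q c
        c-linear x y = trans (⊞-tabulate (λ i → Coordinate.c₀ i ∙ x) (λ i → Coordinate.c₀ i ∙ y))
          (Vec.tabulate-cong (λ i → sym (∙-⊞ (Coordinate.c₀ i) x y)))

        distance : V d → ℤ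
        distance x = + hammingCount q (f x) (c x)

        ∑-distance : ∑V (λ x → χ x * distance x) ≡ ∑ (allFin ℓ) (λ i → a - Coordinate.B i (Coordinate.c₀ i))
        ∑-distance = begin
          ∑V (λ x → χ x * distance x)
            ≡⟨ ∑-cong (allVecs q d) (λ x → trans (cong (χ x *_) (hammingCount-∑ (f x) (c x)))
                 (sym (∑-*ˡ (allFin ℓ) (χ x) (λ i → 1ℤ - ⟦ lookup (c x) i ≟F lookup (f x) i ⟧)))) ⟩
          ∑V (λ x → ∑ (allFin ℓ) (λ i → χ x * (1ℤ - ⟦ lookup (c x) i ≟F lookup (f x) i ⟧)))
            ≡⟨ ∑-swap (allVecs q d) (allFin ℓ) (λ x i → χ x * (1ℤ - ⟦ lookup (c x) i ≟F lookup (f x) i ⟧)) ⟩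
          ∑ (allFin ℓ) (λ i → ∑V (λ x → χ x * (1ℤ - ⟦ lookup (c x) i ≟F lookup (f x) i ⟧)))
            ≡⟨ ∑-cong (allFin ℓ) (λ i → trans (∑-cong (allVecs q d) (disagreement i))
                 (∑-minus (allVecs q d) χ (λ x → χ x * ⟦ Coordinate.K i (Coordinate.c₀ i) x ≟F 0F ⟧))) ⟩
          ∑ (allFin ℓ) (λ i → a - Coordinate.B i (Coordinate.c₀ i)) ∎
          where
          open ≡-Reasoning
          id : ∀ x t → x * (1ℤ - t) ≡ x - x * t
          id = solve-∀
          disagreement : ∀ i x → χ x * (1ℤ - ⟦ lookup (c x) i ≟F lookup (f x) i ⟧) ≡
            χ x - χ x * ⟦ Coordinate.K i (Coordinate.c₀ i) x ≟F 0F ⟧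
          disagreement i x = trans (id (χ x) ⟦ lookup (c x) i ≟F lookup (f x) i ⟧)
            (cong (λ t → χ x - χ x * t)
              (⟦⟧-cong (lookup (c x) i ≟F lookup (f x) i) (Coordinate.K i (Coordinate.c₀ i) x ≟F 0F)
                (λ eq → trans (cong (_⊕ −1F ⊗ lookup (f x) i) (trans (sym value) eq)) (⊕-inverse (lookup (f x) i)))
                (λ eq → trans value (⊕-cancel (Coordinate.c₀ i ∙ x) (lookup (f x) i) eq))))
            where
            value : lookup (c x) i ≡ Coordinate.c₀ i ∙ x
            value = Vec.lookup∘tabulate (λ i → Coordinate.c₀ i ∙ x) i

        -- The bound of `agreement` is the same for all coordinates, so summing costs a factor ℓ,
        -- which the relative distance divides out.
        distance-small : Q * (a * a * ∑V (λ x → χ x * distance x)) ≤ + 5 * (n * n * n) * + ℓ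
        distance-small = begin
          Q * (a * a * ∑V (λ x → χ x * distance x))
            ≡⟨ cong (λ t → Q * (a * a * t)) ∑-distance ⟩
          Q * (a * a * ∑ (allFin ℓ) (λ i → a - Coordinate.B i (Coordinate.c₀ i)))
            ≡⟨ trans (∑-*ˡ (allFin ℓ) Q _) (cong (Q *_) (∑-*ˡ (allFin ℓ) (a * a) _)) ⟨
          ∑ (allFin ℓ) (λ i → Q * (a * a * (a - Coordinate.B i (Coordinate.c₀ i))))
            ≤⟨ ∑-mono (allFin ℓ) Coordinate.agreement ⟩
          ∑ (allFin ℓ) (λ _ → + 5 * (n * n * n))
            ≡⟨ trans (∑-const (allFin ℓ) (+ 5 * (n * n * n)))
                 (cong (λ k → + k * (+ 5 * (n * n * n))) (List.length-tabulate {n = ℓ} (λ i → i))) ⟩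
          + ℓ * (+ 5 * (n * n * n))
            ≡⟨ *-comm (+ ℓ) (+ 5 * (n * n * n)) ⟩
          + 5 * (n * n * n) * + ℓ ∎
          where open ≤-Reasoning

        -- P stands for closeness within κ; leaving it abstract keeps ℚ out of the count. The
        -- threshold s ℓ / n² is ε ℓ.
        module Close {P : V d → Set} (P? : ∀ x → Dec (P x))
          (close : ∀ x → distance x * (n * n) ≤ s * + ℓ → P x) where

          g b : ℤ
          g = ∑V (λ x → ⟦ P? x ⟧)
          b = ∑V (λ x → χ x * (1ℤ - ⟦ P? x ⟧))

          b≥0 : 0ℤ ≤ b
          b≥0 = ∑≥0 (allVecs q d) (λ x → ⟦⟧≥0 (K₁ x ≟F 0F) ·≥ gap (⟦⟧≤1 (P? x)))

          a≤g+b : a ≤ g + b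
          a≤g+b = ≤-trans (∑-mono (allVecs q d) pointwise)
            (≤-reflexive (∑-+ (allVecs q d) (λ x → ⟦ P? x ⟧) (λ x → χ x * (1ℤ - ⟦ P? x ⟧))))
            where
            pointwise : ∀ x → χ x ≤ ⟦ P? x ⟧ + χ x * (1ℤ - ⟦ P? x ⟧)
            pointwise x = gap-by (⟦⟧≥0 (P? x) ·≥ gap (⟦⟧≤1 (K₁ x ≟F 0F))) (id (χ x) ⟦ P? x ⟧)
              where
              id : ∀ x t → t + x * (1ℤ - t) - x ≡ t * (1ℤ - x)
              id = solve-∀

          -- A point that is not close exceeds the threshold, hence by integrality exceeds it by at
          -- least 1.
          markov : b * (s * + ℓ + 1ℤ) ≤ n * n * ∑V (λ x → χ x * distance x)
          markov = begin
            b * (s * + ℓ + 1ℤ)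
              ≡⟨ ∑-*ʳ (allVecs q d) (λ x → χ x * (1ℤ - ⟦ P? x ⟧)) (s * + ℓ + 1ℤ) ⟨
            ∑V (λ x → χ x * (1ℤ - ⟦ P? x ⟧) * (s * + ℓ + 1ℤ))
              ≤⟨ ∑-mono (allVecs q d) (λ x → subst₂ _≤_
                   (sym (*-assoc (χ x) (1ℤ - ⟦ P? x ⟧) (s * + ℓ + 1ℤ)))
                   (id (χ x) (distance x) (n * n))
                   (·-monoˡ (⟦⟧≥0 (K₁ x ≟F 0F)) (pointwise x))) ⟩
            ∑V (λ x → n * n * (χ x * distance x))
              ≡⟨ ∑-*ˡ (allVecs q d) (n * n) (λ x → χ x * distance x) ⟩
            n * n * ∑V (λ x → χ x * distance x) ∎
            where
            open ≤-Reasoning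
            id : ∀ x t m → x * (t * m) ≡ m * (x * t)
            id = solve-∀
            pointwise : ∀ x → (1ℤ - ⟦ P? x ⟧) * (s * + ℓ + 1ℤ) ≤ distance x * (n * n)
            pointwise x = ⟦⟧-unless (P? x)
              (0≤+ (hammingCount q (f x) (c x)) ·≥ n≥0 ·≥ n≥0)
              (λ ¬p → ≤-trans (≤-reflexive (+-comm (s * + ℓ) 1ℤ))
                (i<j⇒suc[i]≤j (≰⇒> (λ le → ¬p (close x le)))))

          many-close : s * s ≤ + 3 * (n * n * n) * g
          many-close = good-bound b≥0 (0≤+ ℓ) distance-small markov a≤g+b

open Counting
open import Data.Nat using (ℕ; NonZero; _^_)
open import Data.Nat.Primality using (Prime)
open import Data.Fin using (Fin)
open import Data.Vec using (Vec)
open import Data.List using (length)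
open import Data.Product using (Σ; _×_)
open import Data.Rational using (ℚ; 0ℚ; _<_; _≤_; _*_)
open import Relation.Binary.PropositionalEquality using (_≡_)

open import Data.Integer as ℤ using (ℤ; +_; 0ℤ; 1ℤ)
import Data.Integer.Properties as ℤ
open import Data.List using (filter; concatMap)
open import Data.List.Membership.Propositional using (lose)
open import Data.List.Relation.Unary.Any using (Any)
import Data.Nat as ℕ
import Data.Nat.Properties as ℕ
open import Data.Product using (_,_)
import Data.Rational as ℚ
import Data.Rational.Properties as ℚ
open import Data.Rational.Solver using (module +-*-Solver)
open import Data.Rational.Unnormalised as ℚᵘ using (mkℚᵘ)
import Data.Rational.Unnormalised.Properties as ℚᵘ
open import Relation.Binary.PropositionalEquality using (refl; sym; trans; cong; subst₂)

-- From integer counts to rational probabilities.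

ι : ℤ → ℚ
ι z = z ℚ./ 1

ι-* : ∀ x y → ι (x ℤ.* y) ≡ ι x * ι y
ι-* x y = ℚ.toℚᵘ-injective (begin
  ℚ.toℚᵘ (ι (x ℤ.* y))               ≈⟨ ℚ.toℚᵘ-fromℚᵘ (mkℚᵘ (x ℤ.* y) 0) ⟩
  mkℚᵘ x 0 ℚᵘ.* mkℚᵘ y 0             ≈⟨ ℚᵘ.*-cong (ℚ.toℚᵘ-fromℚᵘ (mkℚᵘ x 0)) (ℚ.toℚᵘ-fromℚᵘ (mkℚᵘ y 0)) ⟨
  ℚ.toℚᵘ (ι x) ℚᵘ.* ℚ.toℚᵘ (ι y)     ≈⟨ ℚ.toℚᵘ-homo-* (ι x) (ι y) ⟨
  ℚ.toℚᵘ (ι x * ι y) ∎)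
  where open import Relation.Binary.Reasoning.Setoid ℚᵘ.≃-setoid

ι-mono-≤ : ∀ {x y} → x ℤ.≤ y → ι x ≤ ι y
ι-mono-≤ {x} {y} x≤y = ℚ.toℚᵘ-cancel-≤
  (ℚᵘ.≤-respˡ-≃ (ℚᵘ.≃-sym (ℚ.toℚᵘ-fromℚᵘ (mkℚᵘ x 0)))
    (ℚᵘ.≤-respʳ-≃ (ℚᵘ.≃-sym (ℚ.toℚᵘ-fromℚᵘ (mkℚᵘ y 0)))
      (ℚᵘ.*≤* (subst₂ ℤ._≤_ (sym (ℤ.*-identityʳ x)) (sym (ℤ.*-identityʳ y)) x≤y))))

ι-cancel-≤ : ∀ {x y} → ι x ≤ ι y → x ℤ.≤ y
ι-cancel-≤ {x} {y} le
  with ℚᵘ.*≤* x*1≤y*1 ← ℚᵘ.≤-respˡ-≃ (ℚ.toℚᵘ-fromℚᵘ (mkℚᵘ x 0))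
         (ℚᵘ.≤-respʳ-≃ (ℚ.toℚᵘ-fromℚᵘ (mkℚᵘ y 0)) (ℚ.toℚᵘ-mono-≤ le))
  = subst₂ ℤ._≤_ (ℤ.*-identityʳ x) (ℤ.*-identityʳ y) x*1≤y*1

ι-pos : ∀ {x} → 0ℤ ℤ.< x → ℚ.Positive (ι x)
ι-pos {ℤ.+[1+ n ]} _ = ℚ.normalize-pos (ℕ.suc n) 1
ι-pos {+ 0} (ℤ.+<+ ())

module Scaling (q : ℕ) .{{_ : NonZero q}} (pr : Prime q) (d ℓ : ℕ)
  (f : Vec (Fin q) d → Vec (Fin q) ℓ) (f-hom : ScalarRespecting q f) where

  open Vectors q pr
  open LinearityTest q pr
  open Decoding d ℓ f f-hom

  sizeS-∑ : + sizeS q f ≡ s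
  sizeS-∑ = trans (length-as-∑ (concatMap (λ x → filter (accepts? q f x) (allVecs q d)) (allVecs q d)))
    (trans (∑-concatMap (λ x → filter (accepts? q f x) (allVecs q d)) (allVecs q d) (λ _ → 1ℤ))
      (∑-cong (allVecs q d) (λ x → trans (∑-filter (accepts? q f x) (allVecs q d) (λ _ → 1ℤ))
        (∑-cong (allVecs q d) (λ y → ℤ.*-identityʳ ⟦ accepts? q f x y ⟧)))))

  inVar : ∀ x → Any (Accepts q f x) (allVecs q d)
  inVar x = lose (vectors-complete 0V)
    (trans (cong (f x ⊞_) f-0V) (trans (⊞-identityʳ (f x)) (cong f (sym (⊞-identityʳ x)))))
    where
    f-0V : f 0V ≡ 0V
    f-0V = trans (cong f (sym (⊡-zero 0V))) (trans (f-hom (Residues.0F q) 0V) (⊡-zero (f 0V)))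

  ∑-varList : ∀ G → ∑ (varList q f) G ≡ ∑V G
  ∑-varList G = trans (∑-filter (inVar? q f) (allVecs q d) G)
    (∑-cong (allVecs q d) (λ x → trans (cong (ℤ._* G x) (⟦⟧-yes (inVar? q f x) (inVar x))) (ℤ.*-identityˡ (G x))))

  varList-length : + length (varList q f) ≡ n
  varList-length = trans (length-as-∑ (varList q f))
    (trans (∑-varList (λ _ → 1ℤ)) (trans (∑V-const d 1ℤ) (ℤ.*-identityʳ n)))

  goodCount-∑ : ∀ c κ → + goodCount q f c κ ≡ ∑V (λ x → ⟦ close? q κ (f x) (c x) ⟧)
  goodCount-∑ c κ = trans (length-as-∑ (filter (λ x → close? q κ (f x) (c x)) (varList q f)))
    (trans (∑-filter (λ x → close? q κ (f x) (c x)) (varList q f) (λ _ → 1ℤ))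
      (trans (∑-varList _) (∑-cong (allVecs q d) (λ x → ℤ.*-identityʳ ⟦ close? q κ (f x) (c x) ⟧))))

  -- Since `toℚ m` unfolds to `ι (+ m)`, the rational quantities of the theorem are images of
  -- integer counts under `ι`, with ε = σ / ν².
  ν σ : ℚ
  ν = ι n
  σ = ι s

  instance
    ν-pos : ℚ.Positive ν
    ν-pos = ι-pos n>0

    ν²-pos : ℚ.Positive (ν * ν)
    ν²-pos = ℚ.pos*pos⇒pos ν ν

    ν³-pos : ℚ.Positive (ν * ν * ν)
    ν³-pos = ℚ.pos*pos⇒pos (ν * ν) ν

  n²-power : + (q ^ (2 ℕ.* d)) ≡ n ℤ.* n
  n²-power = trans (cong (λ k → + (q ^ (d ℕ.+ k))) (ℕ.+-identityʳ d))
    (trans (cong +_ (ℕ.^-distribˡ-+-* q d d)) (ℤ.pos-* (q ^ d) (q ^ d)))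

  module Parameters (ε κ : ℚ) (ε≤κ : ε ≤ κ) (threshold : toℚ 200 ≤ ε * ε * ε * toℚ q)
    (probability : ε * toℚ (q ^ (2 ℕ.* d)) ≡ toℚ (sizeS q f)) where

    open +-*-Solver using (solve; _:*_; _:=_)

    εν²≡σ : ε * (ν * ν) ≡ σ
    εν²≡σ = trans (cong (ε *_) (trans (sym (ι-* n n)) (cong ι (sym n²-power))))
      (trans probability (cong ι sizeS-∑))

    ι-cube : ∀ x → ι (x ℤ.* x ℤ.* x) ≡ ι x * ι x * ι x
    ι-cube x = trans (ι-* (x ℤ.* x) x) (cong (_* ι x) (ι-* x x))

    ι-sixth : ∀ x → ι (x ℤ.* x ℤ.* x ℤ.* x ℤ.* x ℤ.* x) ≡ ι x * ι x * ι x * ι x * ι x * ι x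
    ι-sixth x = trans (ι-* (x ℤ.* x ℤ.* x ℤ.* x ℤ.* x) x) (cong (_* ι x)
      (trans (ι-* (x ℤ.* x ℤ.* x ℤ.* x) x) (cong (_* ι x)
        (trans (ι-* (x ℤ.* x ℤ.* x) x) (cong (_* ι x) (ι-cube x))))))

    -- The threshold on ε³ q, multiplied by ν⁶.
    large : + 200 ℤ.* (n ℤ.* n ℤ.* n ℤ.* n ℤ.* n ℤ.* n) ℤ.≤ Q ℤ.* (s ℤ.* s ℤ.* s)
    large = ι-cancel-≤ (begin
      ι (+ 200 ℤ.* (n ℤ.* n ℤ.* n ℤ.* n ℤ.* n ℤ.* n))
        ≡⟨ trans (ι-* (+ 200) (n ℤ.* n ℤ.* n ℤ.* n ℤ.* n ℤ.* n)) (cong (toℚ 200 *_) (ι-sixth n)) ⟩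
      toℚ 200 * (ν * ν * ν * ν * ν * ν)
        ≡⟨ solve 2 (λ c v → c :* (v :* v :* v :* v :* v :* v) := c :* (v :* v :* v) :* (v :* v :* v)) refl (toℚ 200) ν ⟩
      toℚ 200 * (ν * ν * ν) * (ν * ν * ν)
        ≤⟨ ℚ.*-monoʳ-≤-nonNeg (ν * ν * ν) {{ℚ.pos⇒nonNeg (ν * ν * ν)}}
             (ℚ.*-monoʳ-≤-nonNeg (ν * ν * ν) {{ℚ.pos⇒nonNeg (ν * ν * ν)}} threshold) ⟩
      ε * ε * ε * toℚ q * (ν * ν * ν) * (ν * ν * ν)
        ≡⟨ solve 3 (λ e c v → e :* e :* e :* c :* (v :* v :* v) :* (v :* v :* v) :=
             c :* ((e :* (v :* v)) :* (e :* (v :* v)) :* (e :* (v :* v)))) refl ε (toℚ q) ν ⟩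
      toℚ q * (ε * (ν * ν) * (ε * (ν * ν)) * (ε * (ν * ν)))
        ≡⟨ cong (λ t → toℚ q * (t * t * t)) εν²≡σ ⟩
      toℚ q * (σ * σ * σ)
        ≡⟨ trans (ι-* Q (s ℤ.* s ℤ.* s)) (cong (toℚ q *_) (ι-cube s)) ⟨
      ι (Q ℤ.* (s ℤ.* s ℤ.* s)) ∎)
      where open ℚ.≤-Reasoning

    open Dense large

    -- After division by n² the chain is distance ≤ ε ℓ ≤ κ ℓ.
    close : ∀ x → distance x ℤ.* (n ℤ.* n) ℤ.≤ s ℤ.* + ℓ → CloseWithin q κ (f x) (c x)
    close x le = ℚ.*-cancelʳ-≤-pos (ν * ν) (begin
      ι (distance x) * (ν * ν)
        ≡⟨ trans (ι-* (distance x) (n ℤ.* n)) (cong (ι (distance x) *_) (ι-* n n)) ⟨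
      ι (distance x ℤ.* (n ℤ.* n))
        ≤⟨ ι-mono-≤ le ⟩
      ι (s ℤ.* + ℓ)
        ≡⟨ trans (ι-* s (+ ℓ)) (cong (_* toℚ ℓ) (sym εν²≡σ)) ⟩
      ε * (ν * ν) * toℚ ℓ
        ≤⟨ ℚ.*-monoʳ-≤-nonNeg (toℚ ℓ) {{ℚ.normalize-nonNeg ℓ 1}}
             (ℚ.*-monoʳ-≤-nonNeg (ν * ν) {{ℚ.pos⇒nonNeg (ν * ν)}} ε≤κ) ⟩
      κ * (ν * ν) * toℚ ℓ
        ≡⟨ solve 3 (λ k m l → k :* m :* l := k :* l :* m) refl κ (ν * ν) (toℚ ℓ) ⟩
      κ * toℚ ℓ * (ν * ν) ∎)
      where open ℚ.≤-Reasoning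

    -- This is `many-close` divided by n³: s² / n³ is ε² n, and n is the size of var(f, 𝒯).
    conclusion : ε * ε * toℚ (length (varList q f)) ≤ toℚ 3 * toℚ (goodCount q f c κ)
    conclusion = ℚ.*-cancelʳ-≤-pos (ν * ν * ν) (begin
      ε * ε * toℚ (length (varList q f)) * (ν * ν * ν)
        ≡⟨ cong (λ t → ε * ε * t * (ν * ν * ν)) (cong ι varList-length) ⟩
      ε * ε * ν * (ν * ν * ν)
        ≡⟨ solve 2 (λ e v → e :* e :* v :* (v :* v :* v) := (e :* (v :* v)) :* (e :* (v :* v))) refl ε ν ⟩
      ε * (ν * ν) * (ε * (ν * ν))
        ≡⟨ cong (λ t → t * t) εν²≡σ ⟩
      σ * σ
        ≡⟨ ι-* s s ⟨
      ι (s ℤ.* s)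
        ≤⟨ ι-mono-≤ (Close.many-close (λ x → close? q κ (f x) (c x)) close) ⟩
      ι (+ 3 ℤ.* (n ℤ.* n ℤ.* n) ℤ.* g)
        ≡⟨ trans (ι-* (+ 3 ℤ.* (n ℤ.* n ℤ.* n)) g)
             (cong (_* ι g) (trans (ι-* (+ 3) (n ℤ.* n ℤ.* n)) (cong (toℚ 3 *_) (ι-cube n)))) ⟩
      toℚ 3 * (ν * ν * ν) * ι g
        ≡⟨ solve 3 (λ t m g → t :* m :* g := t :* g :* m) refl (toℚ 3) (ν * ν * ν) (ι g) ⟩
      toℚ 3 * ι g * (ν * ν * ν)
        ≡⟨ cong (λ t → toℚ 3 * ι t * (ν * ν * ν)) (goodCount-∑ c κ) ⟨
      toℚ 3 * toℚ (goodCount q f c κ) * (ν * ν * ν) ∎)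
      where
      open ℚ.≤-Reasoning
      g : ℤ
      g = ∑V (λ x → ⟦ close? q κ (f x) (c x) ⟧)

theorem3p2 : Σ ℕ λ C →
    (q : ℕ) .{{_ : NonZero q}} → Prime q →
    (d ℓ : ℕ) (f : Vec (Fin q) d → Vec (Fin q) ℓ) →
    ScalarRespecting q f →
    (ε κ : ℚ) → 0ℚ < ε → ε ≤ κ →
    toℚ C ≤ ε * ε * ε * toℚ q →
    ε * toℚ (q ^ (2 Data.Nat.* d)) ≡ toℚ (sizeS q f) →
    Σ (Vec (Fin q) d → Vec (Fin q) ℓ) λ c →
    Linear q c ×
    (ε * ε * toℚ (length (varList q f)) ≤ toℚ 3 * toℚ (goodCount q f c κ))
-- The relation ε ≫ q^(-1/3) is made quantitative as ε³ q ≥ 200, the constant in `large`.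
theorem3p2 = 200 , λ q pr d ℓ f f-hom ε κ ε>0 ε≤κ threshold probability →
  let open Scaling q pr d ℓ f f-hom
      open Parameters ε κ ε≤κ threshold probability
      open LinearityTest.Decoding.Dense q pr d ℓ f f-hom large
  in c , c-linear , conclusion
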